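{- Let $G$ be the dot-product graph on $\mathbb{F}_q^t$ and let $U\subset \mathbb{F}_q^t\setminus\{0\}$ be a set of vertices. There is a constant $C$ such that: (1) if $|U|\ge Cq^{\frac{t+1}{2}}$, then the VC-dimension of $\mathcal{H}(U)$ is at least $2$; (2) if $|U|\ge C\max\{q^{\frac{7t+19}{14}}, q^{t-1}\}$, then the VC-dimension of $\mathcal{H}(U)$ is at least $3$.
   Context: $\mathbb{F}_q$ is the finite field with $q$ elements. The dot-product graph in $\mathbb{F}_q^t$ has vertex set $\mathbb{F}_q^t\setminus\{(0,\dots,0)\}$, with $x=(x_1,\dots,x_t)$ and $y=(y_1,\dots,y_t)$ adjacent ($x\sim y$) if $x_1y_1+\cdots+x_ty_t=1$. For $U$ a set of vertices and $v\in U$, let $h_v\colon U\to\{0,1\}$ be given by $h_v(u)=1$ if $u\sim v$ and $0$ otherwise, and $\mathcal{H}(U)=\{h_v:v\in U\}$. A collection $\mathcal{H}$ of functions $V\to\{0,1\}$ shatters a finite set $X\subset V$ if its restrictions to $X$ give every function $X\to\{0,1\}$; the VC-dimension of $\mathcal{H}$ is the largest size of a set shattered by $\mathcal{H}$. -}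

module Defs where

open import Level using (0ℓ)
open import Data.Nat using (ℕ)
open import Data.Fin using (Fin)
open import Data.Bool using (Bool; true)
open import Data.Vec using (Vec; foldr; zipWith; replicate; lookup)
open import Data.List using (List; length)
open import Data.List.Relation.Unary.All using (All)
open import Data.List.Relation.Unary.Unique.Propositional using (Unique)
open import Data.List.Membership.Propositional using (_∈_)
import Data.List as L
open import Data.Product using (Σ; ∃; _×_)
open import Relation.Binary.PropositionalEquality using (_≡_; _≢_)
open import Algebra.Core using (Op₁; Op₂)
open import Algebra.Structures using (IsCommutativeRing)
open import Function.Bundles using (_↔_)

record FiniteField : Set₁ where
  field
    Carrier : Set
    _+_ _*_ : Op₂ Carrier
    -_ : Op₁ Carrier
    0# 1# : Carrier
    isCommutativeRing : IsCommutativeRing _≡_ _+_ _*_ -_ 0# 1#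
    0≢1 : 0# ≢ 1#
    inverse : ∀ x → x ≢ 0# → ∃ λ y → x * y ≡ 1#
    order : ℕ
    enumeration : Carrier ↔ Fin order

module _ (F : FiniteField) where
  open FiniteField F

  Point : ℕ → Set
  Point t = Vec Carrier t

  zeroVec : ∀ {t} → Point t
  zeroVec = replicate _ 0#

  dot : ∀ {t} → Point t → Point t → Carrier
  dot x y = foldr _ _+_ 0# (zipWith _*_ x y)

  _∼_ : ∀ {t} → Point t → Point t → Set
  x ∼ y = dot x y ≡ 1#

  IsVertexSet : ∀ {t} → List (Point t) → Set
  IsVertexSet U = Unique U × All (λ x → x ≢ zeroVec) U

  -- h_v(u) = 1 iff u ∼ v ; H(U) = { h_v : v ∈ U } shatters X ⊆ U:
  -- every function X → {0,1} is the restriction of some h_v, v ∈ U.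
  Shatters : ∀ {t} → List (Point t) → List (Point t) → Set
  Shatters U X =
    All (_∈ U) X ×
    ((f : Fin (length X) → Bool) →
      Σ (Point _) λ v → v ∈ U ×
        (∀ i → (L.lookup X i ∼ v → f i ≡ true) × (f i ≡ true → L.lookup X i ∼ v)))

  VCdim≥ : ∀ {t} → List (Point t) → ℕ → Set
  VCdim≥ U k = Σ (List (Point _)) λ X → Unique X × length X ≡ k × Shatters U X

{-# OPTIONS --safe #-}
module Submission where

-- Write q = |F|, Q = q^t, n = |U|.  For distinct x, y the system x·w = y·w = 1 has at most
-- Q/q² solutions, so for a set A of nonzero vectors, the number N(w) of neighbours in A has
-- variance Σ_w (q N(w) − |A|)² ≤ |A| q Q over all w.  Taking A = U, at least n²/4q edges of
-- U end in vertices of degree between n/4q and n/2 (the good vertices); write A v for the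
-- good neighbours of v.
--
-- Dimension 2: choose v with |A v| ≥ n/4q and x₀ ∈ A v of minimal degree.  The variance bound
-- for A v forbids every x ∈ A v from being adjacent to all neighbours of x₀.  For an x that
-- misses one, minimality of the degree gives a neighbour of x that x₀ misses; v is a common
-- neighbour, and the upper bound on degrees leaves a vertex adjacent to neither.
--
-- Dimension 3: for t ≤ 2 the hypothesis contradicts n ≤ Q, and for t ≥ 3 the bound
-- n ≥ C q^(t−1) suffices.  Pairs with at most Q/q³ common neighbours account for at most
-- n² Q/q³ ≤ n³/(C q²) paths x – v – y, few compared with the n³/16q² paths through good
-- vertices.  Hence some A v contains x, y, z, not on a line, each two of which have more than
-- Q/q³ common neighbours.  As the three together have at most Q/q³ common neighbours,
-- any two at most Q/q² and any one at most Q/q, counting yields all eight adjacency patterns.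

open import Defs
open import Data.Nat hiding (_≟_)
open import Data.Nat.Properties hiding (_≟_)
open import Data.Nat.Tactic.RingSolver using (solve-∀)
open import Data.Bool using (Bool; true; false)
open import Data.Fin using (zero; suc)
open import Data.Fin.Properties using (inj⇒≟)
import Data.Vec as Vec
open import Data.Vec using ([]; _∷_; zipWith)
open import Data.Vec.Properties using (≡-dec; ∷-injective)
open import Data.List using (List; []; _∷_; length; filter; map; allFin; cartesianProductWith)
open import Data.List.Properties using (length-map; length-tabulate; length-++)
open import Data.List.Relation.Unary.Any using (here; there)
open import Data.List.Relation.Unary.All as All using (All; []; _∷_)
open import Data.List.Relation.Unary.Unique.Propositional using (Unique; []; _∷_)
import Data.List.Relation.Unary.Unique.Propositional.Properties as Unique
open import Data.List.Membership.Propositional using (_∈_)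
open import Data.List.Membership.Propositional.Properties using (∈-map⁺; ∈-allFin; ∈-cartesianProductWith⁺; ∈-filter⁻)
open import Data.Product using (∃; _×_; _,_; proj₁; proj₂)
open import Data.Sum using (inj₁; inj₂)
open import Function.Bundles using (Inverse)
open import Function.Properties.Inverse using (↔⇒↣)
open import Algebra.Bundles using (CommutativeRing)
import Algebra.Properties.CommutativeSemigroup
import Algebra.Properties.Ring
open import Relation.Nullary using (¬_; Dec; yes; no; contradiction; _×-dec_)
open import Relation.Unary using (Decidable)
open import Relation.Binary using (DecidableEquality)
open import Relation.Binary.PropositionalEquality

-- Finite sums over lists and the pigeonhole principle.

private variable
  X Y : Set

∑ : List X → (X → ℕ) → ℕ
∑ []       f = 0
∑ (x ∷ xs) f = f x + ∑ xs f

infixr 5 ∑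
syntax ∑ xs (λ x → e) = ∑[ x ∈ xs ] e

∑-cong : ∀ (xs : List X) {f g} → (∀ x → f x ≡ g x) → ∑ xs f ≡ ∑ xs g
∑-cong []       h = refl
∑-cong (x ∷ xs) h = cong₂ _+_ (h x) (∑-cong xs h)

∑-mono-∈ : ∀ (xs : List X) {f g} → (∀ {x} → x ∈ xs → f x ≤ g x) → ∑ xs f ≤ ∑ xs g
∑-mono-∈ []       h = z≤n
∑-mono-∈ (x ∷ xs) h = +-mono-≤ (h (here refl)) (∑-mono-∈ xs (λ x∈ → h (there x∈)))

∑-mono : ∀ (xs : List X) {f g} → (∀ x → f x ≤ g x) → ∑ xs f ≤ ∑ xs g
∑-mono xs h = ∑-mono-∈ xs (λ {x} _ → h x)

∑-mono-< : ∀ (xs : List X) {f g} → (∀ x → f x ≤ g x) →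
           ∀ {y} → y ∈ xs → f y < g y → ∑ xs f < ∑ xs g
∑-mono-< (x ∷ xs) h (here refl) lt = +-mono-<-≤ lt (∑-mono xs h)
∑-mono-< (x ∷ xs) h (there y∈)  lt = +-mono-≤-< (h x) (∑-mono-< xs h y∈ lt)

∑-+ : ∀ (xs : List X) f g → ∑[ x ∈ xs ] (f x + g x) ≡ ∑ xs f + ∑ xs g
∑-+ []       f g = refl
∑-+ (x ∷ xs) f g = begin
  f x + g x + (∑[ y ∈ xs ] (f y + g y)) ≡⟨ cong (f x + g x +_) (∑-+ xs f g) ⟩
  f x + g x + (∑ xs f + ∑ xs g)       ≡⟨ +-interchange (f x) (g x) _ _ ⟩
  f x + ∑ xs f + (g x + ∑ xs g)       ∎
  where
  open ≡-Reasoning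
  +-interchange : ∀ a b c d → a + b + (c + d) ≡ a + c + (b + d)
  +-interchange = solve-∀

∑-*ˡ : ∀ (xs : List X) c f → ∑[ x ∈ xs ] (c * f x) ≡ c * ∑ xs f
∑-*ˡ []       c f = sym (*-zeroʳ c)
∑-*ˡ (x ∷ xs) c f = trans (cong (c * f x +_) (∑-*ˡ xs c f)) (sym (*-distribˡ-+ c (f x) _))

∑-*ʳ : ∀ (xs : List X) f c → ∑[ x ∈ xs ] (f x * c) ≡ ∑ xs f * c
∑-*ʳ xs f c = begin
  ∑[ x ∈ xs ] (f x * c) ≡⟨ ∑-cong xs (λ x → *-comm (f x) c) ⟩
  ∑[ x ∈ xs ] (c * f x) ≡⟨ ∑-*ˡ xs c f ⟩
  c * ∑ xs f          ≡⟨ *-comm c _ ⟩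
  ∑ xs f * c          ∎
  where open ≡-Reasoning

∑-const : ∀ (xs : List X) c → ∑[ x ∈ xs ] c ≡ length xs * c
∑-const []       c = refl
∑-const (x ∷ xs) c = cong (c +_) (∑-const xs c)

∑-swap : ∀ (xs : List X) (ys : List Y) (f : X → Y → ℕ) →
         ∑[ x ∈ xs ] ∑[ y ∈ ys ] f x y ≡ ∑[ y ∈ ys ] ∑[ x ∈ xs ] f x y
∑-swap []       ys f = sym (trans (∑-const ys 0) (*-zeroʳ (length ys)))
∑-swap (x ∷ xs) ys f = trans (cong (∑ ys (f x) +_) (∑-swap xs ys f))
                             (sym (∑-+ ys (f x) (λ y → ∑[ x ∈ xs ] f x y)))

∑-product : ∀ (xs : List X) (ys : List Y) f g →
            ∑[ x ∈ xs ] ∑[ y ∈ ys ] (f x * g y) ≡ ∑ xs f * ∑ ys g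
∑-product xs ys f g = trans (∑-cong xs (λ x → ∑-*ˡ ys (f x) g)) (∑-*ʳ xs f (∑ ys g))

∑-map : ∀ (τ : X → Y) xs f → ∑ (map τ xs) f ≡ ∑[ x ∈ xs ] f (τ x)
∑-map τ []       f = refl
∑-map τ (x ∷ xs) f = cong (f (τ x) +_) (∑-map τ xs f)

∈⇒≤∑ : ∀ {xs : List X} f {x} → x ∈ xs → f x ≤ ∑ xs f
∈⇒≤∑ f (here refl) = m≤m+n _ _
∈⇒≤∑ f (there x∈)  = ≤-trans (∈⇒≤∑ f x∈) (m≤n+m _ _)

-- The pigeonhole step behind most witnesses below: `f` and `g` are built from adjacency indicators
-- so that strict inequality at one vertex forces the wanted adjacency pattern there.
∑<∑⇒∃< : ∀ (xs : List X) {f g} → ∑ xs f < ∑ xs g → ∃ λ x → x ∈ xs × f x < g x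
∑<∑⇒∃< (x ∷ xs) {f} {g} lt with f x <? g x
... | yes fx<gx = x , here refl , fx<gx
... | no  fx≮gx =
  let y , y∈ , fy<gy = ∑<∑⇒∃< xs (+-cancelˡ-< (g x) _ _
                         (≤-<-trans (+-monoˡ-≤ _ (≮⇒≥ fx≮gx)) lt))
  in y , there y∈ , fy<gy

∑≤∑⇒∃≤ : ∀ (xs : List X) {f g} → 0 < length xs → ∑ xs f ≤ ∑ xs g →
         ∃ λ x → x ∈ xs × f x ≤ g x
∑≤∑⇒∃≤ xs {f} {g} pos le =
  -- Raising `g` by 1 everywhere makes the comparison strict, because the list is nonempty; over the
  -- naturals `f x < 1 + g x` gives back `f x ≤ g x`.
  let x , x∈ , lt = ∑<∑⇒∃< xs {f} {λ x → 1 + g x} (begin-strict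
        ∑ xs f                       ≤⟨ le ⟩
        ∑ xs g                       <⟨ m<n+m _ pos ⟩
        length xs + ∑ xs g           ≡⟨ cong (_+ ∑ xs g) (*-identityʳ _) ⟨
        length xs * 1 + ∑ xs g       ≡⟨ cong (_+ ∑ xs g) (∑-const xs 1) ⟨
        (∑[ x ∈ xs ] 1) + ∑ xs g     ≡⟨ ∑-+ xs (λ _ → 1) g ⟨
        ∑[ x ∈ xs ] (1 + g x)        ∎)
  in x , x∈ , s≤s⁻¹ lt
  where open ≤-Reasoning

∃-minimum : ∀ (f : X → ℕ) xs → 0 < length xs → ∃ λ x → x ∈ xs × (∀ {y} → y ∈ xs → f x ≤ f y)
∃-minimum f (x ∷ [])     _ = x , here refl , λ { (here refl) → ≤-refl }
∃-minimum f (x ∷ y ∷ xs) _ with ∃-minimum f (y ∷ xs) z<s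
... | m , m∈ , min with ≤-total (f x) (f m)
...   | inj₁ x≤m = x , here refl , λ { (here refl) → ≤-refl ; (there z∈) → ≤-trans x≤m (min z∈) }
...   | inj₂ m≤x = m , there m∈ , λ { (here refl) → m≤x ; (there z∈) → min z∈ }

-- Indicators of decidable propositions.

𝟙 : ∀ {P : Set} → Dec P → ℕ
𝟙 (yes _) = 1
𝟙 (no  _) = 0

𝟙-true : ∀ {P : Set} (d : Dec P) → P → 𝟙 d ≡ 1
𝟙-true (yes _) p = refl
𝟙-true (no ¬p) p = contradiction p ¬p

𝟙-false : ∀ {P : Set} (d : Dec P) → ¬ P → 𝟙 d ≡ 0
𝟙-false (yes p) ¬p = contradiction p ¬p
𝟙-false (no _)  ¬p = refl

𝟙-⇔ : ∀ {P Q : Set} (d : Dec P) (e : Dec Q) → (P → Q) → (Q → P) → 𝟙 d ≡ 𝟙 e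
𝟙-⇔ (yes p) e to from = sym (𝟙-true e (to p))
𝟙-⇔ (no ¬p) e to from = sym (𝟙-false e (λ q → ¬p (from q)))

𝟙≤1 : ∀ {P : Set} (d : Dec P) → 𝟙 d ≤ 1
𝟙≤1 (yes _) = ≤-refl
𝟙≤1 (no _)  = z≤n

𝟙-idem : ∀ {P : Set} (d : Dec P) → 𝟙 d * 𝟙 d ≡ 𝟙 d
𝟙-idem (yes _) = refl
𝟙-idem (no _)  = refl

𝟙<1⇒¬ : ∀ {P : Set} (d : Dec P) → 𝟙 d < 1 → ¬ P
𝟙<1⇒¬ (no ¬p) _ = ¬p
𝟙<1⇒¬ (yes _) (s≤s ())

∑-filter : ∀ {P : X → Set} (P? : Decidable P) xs f →
           ∑ (filter P? xs) f ≡ ∑[ x ∈ xs ] (𝟙 (P? x) * f x)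
∑-filter P? []       f = refl
∑-filter P? (x ∷ xs) f with P? x
... | yes _ = cong₂ _+_ (sym (+-identityʳ _)) (∑-filter P? xs f)
... | no _  = ∑-filter P? xs f

-- Sums over lists without duplicates.

module _ (_≟_ : DecidableEquality X) where

  ∑-unique-≤1 : ∀ {xs} → Unique xs → ∀ b → ∑[ x ∈ xs ] 𝟙 (b ≟ x) ≤ 1
  ∑-unique-≤1 {[]}     []         b = z≤n
  ∑-unique-≤1 {x ∷ xs} (x∉ ∷ xs!) b with b ≟ x
  ... | no _     = ∑-unique-≤1 xs! b
  ... | yes refl = ≤-reflexive (cong suc (trans (vanish x∉)
                     (trans (∑-const xs 0) (*-zeroʳ (length xs)))))
    where
    vanish : ∀ {ys} → All (b ≢_) ys → ∑[ y ∈ ys ] 𝟙 (b ≟ y) ≡ ∑[ y ∈ ys ] 0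
    vanish []       = refl
    vanish (b≢ ∷ h) = cong₂ _+_ (𝟙-false (b ≟ _) b≢) (vanish h)

  ∑-unique-≡1 : ∀ {xs} → Unique xs → ∀ {b} → b ∈ xs → ∑[ x ∈ xs ] 𝟙 (b ≟ x) ≡ 1
  ∑-unique-≡1 {xs} xs! {b} b∈ = ≤-antisym (∑-unique-≤1 xs! b)
    (subst (_≤ ∑[ x ∈ xs ] 𝟙 (b ≟ x)) (𝟙-true (b ≟ b) refl) (∈⇒≤∑ (λ x → 𝟙 (b ≟ x)) b∈))

  -- Each `f x` is bounded by the sum over `ys` of `f y` times the indicator of `y = x`; after
  -- exchanging the sums, every `y` is charged at most once because `xs` has no duplicates.
  ∑-⊆ : ∀ {xs ys} → Unique xs → (∀ {x} → x ∈ xs → x ∈ ys) → ∀ f → ∑ xs f ≤ ∑ ys f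
  ∑-⊆ {xs} {ys} xs! sub f = begin
    ∑ xs f                                         ≤⟨ ∑-mono-∈ xs (λ {x} x∈ → begin
        f x                          ≡⟨ *-identityʳ (f x) ⟨
        f x * 1                      ≡⟨ cong (f x *_) (𝟙-true (x ≟ x) refl) ⟨
        f x * 𝟙 (x ≟ x)              ≤⟨ ∈⇒≤∑ (λ y → f y * 𝟙 (y ≟ x)) (sub x∈) ⟩
        ∑[ y ∈ ys ] (f y * 𝟙 (y ≟ x)) ∎) ⟩
    ∑[ x ∈ xs ] ∑[ y ∈ ys ] (f y * 𝟙 (y ≟ x))       ≡⟨ ∑-swap xs ys _ ⟩
    ∑[ y ∈ ys ] ∑[ x ∈ xs ] (f y * 𝟙 (y ≟ x))       ≡⟨ ∑-cong ys (λ y → ∑-*ˡ xs (f y) _) ⟩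
    ∑[ y ∈ ys ] (f y * (∑[ x ∈ xs ] 𝟙 (y ≟ x)))       ≤⟨ ∑-mono ys (λ y → *-monoʳ-≤ (f y) (∑-unique-≤1 xs! y)) ⟩
    ∑[ y ∈ ys ] (f y * 1)                          ≡⟨ ∑-cong ys (λ y → *-identityʳ (f y)) ⟩
    ∑ ys f                                         ∎
    where open ≤-Reasoning

  -- The image of `xs` under an injective map is again free of duplicates and contained in `xs`, so
  -- `∑-⊆` gives one inequality; the inverse map gives the other.
  ∑-bijection : ∀ {xs} → Unique xs → (∀ x → x ∈ xs) → ∀ (τ σ : X → X) →
                (∀ x → τ (σ x) ≡ x) → (∀ x → σ (τ x) ≡ x) → ∀ f →
                ∑[ x ∈ xs ] f (τ x) ≡ ∑ xs f
  ∑-bijection {xs} xs! all τ σ τσ στ f = ≤-antisym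
    (along τ σ στ f)
    (begin
      ∑ xs f                     ≡⟨ ∑-cong xs (λ x → cong f (τσ x)) ⟨
      ∑[ x ∈ xs ] f (τ (σ x))    ≤⟨ along σ τ τσ (λ x → f (τ x)) ⟩
      ∑[ x ∈ xs ] f (τ x)        ∎)
    where
    open ≤-Reasoning
    along : ∀ (τ σ : X → X) → (∀ x → σ (τ x) ≡ x) → ∀ f → ∑[ x ∈ xs ] f (τ x) ≤ ∑ xs f
    along τ σ στ f = subst (_≤ ∑ xs f) (∑-map τ xs f)
      (∑-⊆ (Unique.map⁺ (λ {x} {y} e → trans (sym (στ x)) (trans (cong σ e) (στ y))) xs!) (λ _ → all _) f)

length-cartesianProductWith : ∀ {X Y Z : Set} (f : X → Y → Z) xs ys →
  length (cartesianProductWith f xs ys) ≡ length xs * length ys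
length-cartesianProductWith f []       ys = refl
length-cartesianProductWith f (x ∷ xs) ys = trans (length-++ (map (f x) ys))
  (cong₂ _+_ (length-map (f x) ys) (length-cartesianProductWith f xs ys))

-- The finite field and the list of all points.

module Geometry (F : FiniteField) where
  open FiniteField F using (isCommutativeRing; inverse; enumeration)
    renaming (Carrier to K; _+_ to infixl 6 _+ᶠ_; _*_ to infixl 7 _*ᶠ_; -_ to infix 9 -ᶠ_; 0# to 0ᶠ; 1# to 1ᶠ; order to q)
  private
    commutativeRing : CommutativeRing _ _
    commutativeRing = record { isCommutativeRing = isCommutativeRing }
    module R = CommutativeRing commutativeRing
    module RP = Algebra.Properties.Ring R.ring
    open Algebra.Properties.CommutativeSemigroup R.+-commutativeSemigroup using (interchange)
    module Enum = Inverse enumeration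

  infix 4 _≟ᶠ_ _≟ₚ_

  _≟ᶠ_ : DecidableEquality K
  _≟ᶠ_ = inj⇒≟ (↔⇒↣ enumeration)

  scalars : List K
  scalars = map Enum.from (allFin q)

  scalars! : Unique scalars
  scalars! = Unique.map⁺ (λ {i} {j} e → trans (sym (Enum.inverseˡ refl)) (trans (cong Enum.to e) (Enum.inverseˡ refl))) (Unique.allFin⁺ q)

  ∈-scalars : ∀ a → a ∈ scalars
  ∈-scalars a = subst (_∈ scalars) (Enum.inverseʳ refl) (∈-map⁺ Enum.from (∈-allFin (Enum.to a)))

  length-scalars : length scalars ≡ q
  length-scalars = trans (length-map Enum.from (allFin q)) (length-tabulate (λ i → i))

  instance
    q≢0 : NonZero q
    q≢0 = >-nonZero (subst (0 <_) length-scalars (nonempty (∈-scalars 0ᶠ)))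
      where
      nonempty : ∀ {a : K} {xs} → a ∈ xs → 0 < length xs
      nonempty (here _)  = z<s
      nonempty (there _) = z<s

  private variable
    t : ℕ

  Pt : ℕ → Set
  Pt = Point F

  _≟ₚ_ : DecidableEquality (Pt t)
  _≟ₚ_ = ≡-dec _≟ᶠ_

  points : ∀ t → List (Pt t)
  points zero    = [] ∷ []
  points (suc t) = cartesianProductWith _∷_ scalars (points t)

  points! : ∀ t → Unique (points t)
  points! zero    = [] ∷ []
  points! (suc t) = Unique.cartesianProductWith⁺ _∷_ ∷-injective scalars! (points! t)

  ∈-points : (x : Pt t) → x ∈ points t
  ∈-points []      = here refl
  ∈-points (a ∷ x) = ∈-cartesianProductWith⁺ _∷_ (∈-scalars a) (∈-points x)

  length-points : ∀ t → length (points t) ≡ q ^ t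
  length-points zero    = refl
  length-points (suc t) = trans (length-cartesianProductWith _∷_ scalars (points t))
                                (cong₂ _*_ length-scalars (length-points t))

  -- Vectors, separating vectors and dual vectors.

  infix  8 _·_
  infixl 6 _⊕_
  infixr 8 _⊙_

  _·_ : Pt t → Pt t → K
  _·_ = dot F

  _⊕_ : Pt t → Pt t → Pt t
  _⊕_ = zipWith _+ᶠ_

  _⊙_ : K → Pt t → Pt t
  c ⊙ x = Vec.map (c *ᶠ_) x

  ·-comm : (x y : Pt t) → x · y ≡ y · x
  ·-comm []      []      = refl
  ·-comm (a ∷ x) (b ∷ y) = cong₂ _+ᶠ_ (R.*-comm a b) (·-comm x y)

  ·-zeroʳ : (x : Pt t) → x · zeroVec F ≡ 0ᶠ
  ·-zeroʳ []      = refl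
  ·-zeroʳ (a ∷ x) = trans (cong₂ _+ᶠ_ (R.zeroʳ a) (·-zeroʳ x)) (R.+-identityˡ 0ᶠ)

  ·-⊕ʳ : (x y z : Pt t) → x · (y ⊕ z) ≡ x · y +ᶠ x · z
  ·-⊕ʳ []      []      []      = sym (R.+-identityˡ 0ᶠ)
  ·-⊕ʳ (a ∷ x) (b ∷ y) (c ∷ z) = trans
    (cong₂ _+ᶠ_ (R.distribˡ a b c) (·-⊕ʳ x y z))
    (interchange (a *ᶠ b) (a *ᶠ c) (x · y) (x · z))

  ·-⊙ʳ : ∀ c (x y : Pt t) → x · (c ⊙ y) ≡ c *ᶠ x · y
  ·-⊙ʳ c []      []      = sym (R.zeroʳ c)
  ·-⊙ʳ c (a ∷ x) (b ∷ y) = begin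
    a *ᶠ (c *ᶠ b) +ᶠ x · (c ⊙ y)      ≡⟨ cong₂ _+ᶠ_ (R.*-assoc a c b) (sym (·-⊙ʳ c x y)) ⟨
    (a *ᶠ c) *ᶠ b +ᶠ c *ᶠ x · y       ≡⟨ cong (λ z → z *ᶠ b +ᶠ c *ᶠ x · y) (R.*-comm a c) ⟩
    (c *ᶠ a) *ᶠ b +ᶠ c *ᶠ x · y       ≡⟨ cong (_+ᶠ c *ᶠ x · y) (R.*-assoc c a b) ⟩
    c *ᶠ (a *ᶠ b) +ᶠ c *ᶠ x · y       ≡⟨ R.distribˡ c (a *ᶠ b) (x · y) ⟨
    c *ᶠ (a *ᶠ b +ᶠ x · y)            ∎
    where open ≡-Reasoning

  ·-lineʳ : (x e : Pt t) → ∀ k u → x · (e ⊕ k ⊙ u) ≡ x · e +ᶠ k *ᶠ x · u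
  ·-lineʳ x e k u = trans (·-⊕ʳ x e (k ⊙ u)) (cong (x · e +ᶠ_) (·-⊙ʳ k x u))

  translate-inverse : ∀ (x d : Pt t) {c c′} → c +ᶠ c′ ≡ 0ᶠ → x ⊕ c ⊙ d ⊕ c′ ⊙ d ≡ x
  translate-inverse []      []      _  = refl
  translate-inverse (a ∷ x) (b ∷ d) {c} {c′} e = cong₂ _∷_ (begin
    (a +ᶠ c *ᶠ b) +ᶠ c′ *ᶠ b ≡⟨ R.+-assoc a _ _ ⟩
    a +ᶠ (c *ᶠ b +ᶠ c′ *ᶠ b) ≡⟨ cong (a +ᶠ_) (R.distribʳ b c c′) ⟨
    a +ᶠ (c +ᶠ c′) *ᶠ b      ≡⟨ cong (λ z → a +ᶠ z *ᶠ b) e ⟩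
    a +ᶠ 0ᶠ *ᶠ b             ≡⟨ cong (a +ᶠ_) (R.zeroˡ b) ⟩
    a +ᶠ 0ᶠ                  ≡⟨ R.+-identityʳ a ⟩
    a                        ∎) (translate-inverse x d e)
    where open ≡-Reasoning

  -- At the first coordinate where the two points differ, `e` holds the inverse of the difference;
  -- its other coordinates are zero.
  separate : {x y : Pt t} → x ≢ y → ∃ λ e → x · e ≡ y · e +ᶠ 1ᶠ
  separate {x = []}    {[]}    x≢y = contradiction refl x≢y
  separate {x = a ∷ x} {b ∷ y} ax≢by with a ≟ᶠ b
  ... | yes refl =
    let e , eq = separate (λ x≡y → ax≢by (cong (a ∷_) x≡y)) in
    0ᶠ ∷ e , trans (cong (a *ᶠ 0ᶠ +ᶠ_) eq) (sym (R.+-assoc _ _ _))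
  ... | no a≢b =
    let k , inv = inverse (a +ᶠ -ᶠ b) (λ z → a≢b (RP.x∙y⁻¹≈ε⇒x≈y a b z)) in
    k ∷ zeroVec F , (begin
      a *ᶠ k +ᶠ x · zeroVec F               ≡⟨ cong (a *ᶠ k +ᶠ_) (·-zeroʳ x) ⟩
      a *ᶠ k +ᶠ 0ᶠ                          ≡⟨ cong (λ z → z *ᶠ k +ᶠ 0ᶠ) (begin
          b +ᶠ (a +ᶠ -ᶠ b)   ≡⟨ R.+-comm b _ ⟩
          (a +ᶠ -ᶠ b) +ᶠ b   ≡⟨ R.+-assoc a _ b ⟩
          a +ᶠ (-ᶠ b +ᶠ b)   ≡⟨ cong (a +ᶠ_) (R.-‿inverseˡ b) ⟩
          a +ᶠ 0ᶠ            ≡⟨ R.+-identityʳ a ⟩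
          a                  ∎) ⟨
      (b +ᶠ (a +ᶠ -ᶠ b)) *ᶠ k +ᶠ 0ᶠ         ≡⟨ cong (_+ᶠ 0ᶠ) (R.distribʳ k b _) ⟩
      (b *ᶠ k +ᶠ (a +ᶠ -ᶠ b) *ᶠ k) +ᶠ 0ᶠ    ≡⟨ cong (λ z → (b *ᶠ k +ᶠ z) +ᶠ 0ᶠ) inv ⟩
      (b *ᶠ k +ᶠ 1ᶠ) +ᶠ 0ᶠ                  ≡⟨ R.+-assoc _ _ _ ⟩
      b *ᶠ k +ᶠ (1ᶠ +ᶠ 0ᶠ)                  ≡⟨ cong (b *ᶠ k +ᶠ_) (R.+-comm 1ᶠ 0ᶠ) ⟩
      b *ᶠ k +ᶠ (0ᶠ +ᶠ 1ᶠ)                  ≡⟨ R.+-assoc _ _ _ ⟨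
      (b *ᶠ k +ᶠ 0ᶠ) +ᶠ 1ᶠ                  ≡⟨ cong (λ z → (b *ᶠ k +ᶠ z) +ᶠ 1ᶠ) (·-zeroʳ y) ⟨
      (b *ᶠ k +ᶠ y · zeroVec F) +ᶠ 1ᶠ       ∎)
    where open ≡-Reasoning

  -- A separating vector can thus be corrected along any `u` that does not distinguish `x` from `y`.
  -- The dual vectors below arise from such corrections.
  separate-shift : ∀ {x y e : Pt t} k {u} → x · e ≡ y · e +ᶠ 1ᶠ → x · u ≡ y · u →
                   x · (e ⊕ k ⊙ u) ≡ y · (e ⊕ k ⊙ u) +ᶠ 1ᶠ
  separate-shift {x = x} {y} {e} k {u} eq equ = begin
    x · (e ⊕ k ⊙ u)                ≡⟨ ·-lineʳ x e k u ⟩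
    x · e +ᶠ k *ᶠ x · u            ≡⟨ cong₂ (λ a b → a +ᶠ k *ᶠ b) eq equ ⟩
    (y · e +ᶠ 1ᶠ) +ᶠ k *ᶠ y · u    ≡⟨ R.+-assoc _ _ _ ⟩
    y · e +ᶠ (1ᶠ +ᶠ k *ᶠ y · u)    ≡⟨ cong (y · e +ᶠ_) (R.+-comm 1ᶠ _) ⟩
    y · e +ᶠ (k *ᶠ y · u +ᶠ 1ᶠ)    ≡⟨ R.+-assoc _ _ _ ⟨
    (y · e +ᶠ k *ᶠ y · u) +ᶠ 1ᶠ    ≡⟨ cong (_+ᶠ 1ᶠ) (·-lineʳ y e k u) ⟨
    y · (e ⊕ k ⊙ u) +ᶠ 1ᶠ          ∎
    where open ≡-Reasoning

  -- One elimination step, with `u` as the pivot for `x`.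
  ·-annihilate : ∀ (x e : Pt t) {u} → x · u ≡ 1ᶠ → x · (e ⊕ (-ᶠ (x · e)) ⊙ u) ≡ 0ᶠ
  ·-annihilate x e {u} xu = begin
    x · (e ⊕ (-ᶠ (x · e)) ⊙ u)         ≡⟨ ·-lineʳ x e _ u ⟩
    x · e +ᶠ (-ᶠ (x · e)) *ᶠ x · u     ≡⟨ cong (λ z → x · e +ᶠ (-ᶠ (x · e)) *ᶠ z) xu ⟩
    x · e +ᶠ (-ᶠ (x · e)) *ᶠ 1ᶠ        ≡⟨ cong (x · e +ᶠ_) (R.*-identityʳ _) ⟩
    x · e +ᶠ -ᶠ (x · e)                ≡⟨ R.-‿inverseʳ _ ⟩
    0ᶠ                                 ∎
    where open ≡-Reasoning

  dual₁ : {w : Pt t} → w ≢ zeroVec F → ∃ λ d → w · d ≡ 1ᶠ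
  dual₁ w≢0 = let d , eq = separate w≢0 in
    d , trans eq (trans (cong (_+ᶠ 1ᶠ) (trans (·-comm (zeroVec F) d) (·-zeroʳ d))) (R.+-identityˡ 1ᶠ))

  -- Distinct points with a common neighbour `v` are linearly independent. Concretely, a vector
  -- separating `y` from `x` is corrected along `v`, on which both take the value 1.
  dual₂ : ∀ (x y v : Pt t) → x · v ≡ 1ᶠ → y · v ≡ 1ᶠ → x ≢ y → ∃ λ d → x · d ≡ 0ᶠ × y · d ≡ 1ᶠ
  dual₂ x y v xv yv x≢y =
    let e , eq = separate (λ y≡x → x≢y (sym y≡x))
        xd     = ·-annihilate x e xv
    in e ⊕ (-ᶠ (x · e)) ⊙ v , xd ,
       trans (separate-shift {x = y} {x} {e} _ {v} eq (trans yv (sym xv))) (trans (cong (_+ᶠ 1ᶠ) xd) (R.+-identityˡ 1ᶠ))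

  -- The coefficients add up to 1, so a common neighbour of `x` and `y` is adjacent to every point
  -- of the line.
  line : Pt t → Pt t → K → Pt t
  line x y c = (1ᶠ +ᶠ -ᶠ c) ⊙ x ⊕ c ⊙ y

  ·-line : ∀ (x y : Pt t) c u → line x y c · u ≡ (1ᶠ +ᶠ -ᶠ c) *ᶠ x · u +ᶠ c *ᶠ y · u
  ·-line x y c u = begin
    line x y c · u                                 ≡⟨ ·-comm (line x y c) u ⟩
    u · line x y c                                 ≡⟨ ·-lineʳ u _ c y ⟩
    u · ((1ᶠ +ᶠ -ᶠ c) ⊙ x) +ᶠ c *ᶠ u · y           ≡⟨ cong (_+ᶠ c *ᶠ u · y) (·-⊙ʳ _ u x) ⟩
    (1ᶠ +ᶠ -ᶠ c) *ᶠ u · x +ᶠ c *ᶠ u · y            ≡⟨ cong₂ (λ a b → (1ᶠ +ᶠ -ᶠ c) *ᶠ a +ᶠ c *ᶠ b) (·-comm u x) (·-comm u y) ⟩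
    (1ᶠ +ᶠ -ᶠ c) *ᶠ x · u +ᶠ c *ᶠ y · u            ∎
    where open ≡-Reasoning

  1-c+c : ∀ c → (1ᶠ +ᶠ -ᶠ c) +ᶠ c ≡ 1ᶠ
  1-c+c c = trans (R.+-assoc 1ᶠ _ c) (trans (cong (1ᶠ +ᶠ_) (R.-‿inverseˡ c)) (R.+-identityʳ 1ᶠ))

  -- A vector separating `z` from a point `l` of the line is corrected along `v` and then along `d₁`
  -- until `x` and `y` vanish on it. Then `l` vanishes too, and the preserved difference says that
  -- `z` takes the value 1.
  dual₃ : ∀ (x y z v : Pt t) → x · v ≡ 1ᶠ → y · v ≡ 1ᶠ → z · v ≡ 1ᶠ →
          x ≢ y → (∀ c → z ≢ line x y c) →
          ∃ λ d → x · d ≡ 0ᶠ × y · d ≡ 0ᶠ × z · d ≡ 1ᶠ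
  dual₃ x y z v xv yv zv x≢y off =
    let d₁ , xd₁ , yd₁ = dual₂ x y v xv yv x≢y
        -- This parameter makes `l` agree with `z` on `d₁`; they agree on `v` as well, so both
        -- corrections preserve the separation of `z` from `l`.
        c      = z · d₁
        l      = line x y c
        e , eq = separate (off c)
        lv     : l · v ≡ 1ᶠ
        lv     = begin
          l · v                                 ≡⟨ ·-line x y c v ⟩
          (1ᶠ +ᶠ -ᶠ c) *ᶠ x · v +ᶠ c *ᶠ y · v   ≡⟨ cong₂ (λ a b → (1ᶠ +ᶠ -ᶠ c) *ᶠ a +ᶠ c *ᶠ b) xv yv ⟩
          (1ᶠ +ᶠ -ᶠ c) *ᶠ 1ᶠ +ᶠ c *ᶠ 1ᶠ         ≡⟨ cong₂ _+ᶠ_ (R.*-identityʳ _) (R.*-identityʳ c) ⟩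
          (1ᶠ +ᶠ -ᶠ c) +ᶠ c                     ≡⟨ 1-c+c c ⟩
          1ᶠ                                    ∎
        ld₁    : l · d₁ ≡ c
        ld₁    = begin
          l · d₁                                ≡⟨ ·-line x y c d₁ ⟩
          (1ᶠ +ᶠ -ᶠ c) *ᶠ x · d₁ +ᶠ c *ᶠ y · d₁ ≡⟨ cong₂ (λ a b → (1ᶠ +ᶠ -ᶠ c) *ᶠ a +ᶠ c *ᶠ b) xd₁ yd₁ ⟩
          (1ᶠ +ᶠ -ᶠ c) *ᶠ 0ᶠ +ᶠ c *ᶠ 1ᶠ         ≡⟨ cong₂ _+ᶠ_ (R.zeroʳ _) (R.*-identityʳ c) ⟩
          0ᶠ +ᶠ c                               ≡⟨ R.+-identityˡ c ⟩
          c                                     ∎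
        e₁     = e ⊕ (-ᶠ (x · e)) ⊙ v
        d      = e₁ ⊕ (-ᶠ (y · e₁)) ⊙ d₁
        xd : x · d ≡ 0ᶠ
        xd = begin
          x · d                                    ≡⟨ ·-lineʳ x e₁ _ d₁ ⟩
          x · e₁ +ᶠ (-ᶠ (y · e₁)) *ᶠ x · d₁        ≡⟨ cong₂ (λ a b → a +ᶠ (-ᶠ (y · e₁)) *ᶠ b) (·-annihilate x e xv) xd₁ ⟩
          0ᶠ +ᶠ (-ᶠ (y · e₁)) *ᶠ 0ᶠ                ≡⟨ R.+-identityˡ _ ⟩
          (-ᶠ (y · e₁)) *ᶠ 0ᶠ                      ≡⟨ R.zeroʳ _ ⟩
          0ᶠ                                       ∎
        yd = ·-annihilate y e₁ yd₁
        ld : l · d ≡ 0ᶠ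
        ld = begin
          l · d                                 ≡⟨ ·-line x y c d ⟩
          (1ᶠ +ᶠ -ᶠ c) *ᶠ x · d +ᶠ c *ᶠ y · d   ≡⟨ cong₂ (λ a b → (1ᶠ +ᶠ -ᶠ c) *ᶠ a +ᶠ c *ᶠ b) xd yd ⟩
          (1ᶠ +ᶠ -ᶠ c) *ᶠ 0ᶠ +ᶠ c *ᶠ 0ᶠ         ≡⟨ cong₂ _+ᶠ_ (R.zeroʳ _) (R.zeroʳ c) ⟩
          0ᶠ +ᶠ 0ᶠ                              ≡⟨ R.+-identityˡ 0ᶠ ⟩
          0ᶠ                                    ∎
    in d , xd , yd , (begin
         z · d         ≡⟨ separate-shift {x = z} {l} {e₁} _ {d₁}
                           (separate-shift {x = z} {l} {e} _ {v} eq (trans zv (sym lv))) (sym ld₁) ⟩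
         l · d +ᶠ 1ᶠ   ≡⟨ cong (_+ᶠ 1ᶠ) ld ⟩
         0ᶠ +ᶠ 1ᶠ      ≡⟨ R.+-identityˡ 1ᶠ ⟩
         1ᶠ            ∎)
    where open ≡-Reasoning

  -- Counting solutions of linear systems by translation.

  E : Pt t → Pt t → ℕ
  E x y = 𝟙 (x · y ≟ᶠ 1ᶠ)

  E-sym : (x y : Pt t) → E x y ≡ E y x
  E-sym x y = cong (λ a → 𝟙 (a ≟ᶠ 1ᶠ)) (·-comm x y)

  E-invariant : ∀ (x d : Pt t) → x · d ≡ 0ᶠ → ∀ c y → E x (y ⊕ c ⊙ d) ≡ E x y
  E-invariant x d xd c y = cong (λ a → 𝟙 (a ≟ᶠ 1ᶠ)) (begin
    x · (y ⊕ c ⊙ d)       ≡⟨ ·-lineʳ x y c d ⟩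
    x · y +ᶠ c *ᶠ x · d   ≡⟨ cong (λ z → x · y +ᶠ c *ᶠ z) xd ⟩
    x · y +ᶠ c *ᶠ 0ᶠ      ≡⟨ cong (x · y +ᶠ_) (R.zeroʳ c) ⟩
    x · y +ᶠ 0ᶠ           ≡⟨ R.+-identityʳ _ ⟩
    x · y                 ∎)
    where open ≡-Reasoning

  ∑-translate : ∀ (d : Pt t) c f → ∑[ x ∈ points t ] f (x ⊕ c ⊙ d) ≡ ∑ (points t) f
  ∑-translate d c = ∑-bijection _≟ₚ_ (points! _) ∈-points (_⊕ c ⊙ d) (_⊕ (-ᶠ c) ⊙ d)
    (λ x → translate-inverse x d (R.-‿inverseˡ c)) (λ x → translate-inverse x d (R.-‿inverseʳ c))

  -- The `q` translations along `d` permute the points and preserve the weight `S`. Of the `q`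
  -- translates of a point, exactly one lies on the hyperplane of neighbours of `w`.
  hyperplane-count : ∀ (w d : Pt t) (S : Pt t → ℕ) → (∀ c x → S (x ⊕ c ⊙ d) ≡ S x) → w · d ≡ 1ᶠ →
                     q * (∑[ x ∈ points t ] S x * E w x) ≡ ∑ (points t) S
  hyperplane-count {t} w d S inv wd = begin
    q * T                                                      ≡⟨ cong (_* T) length-scalars ⟨
    length scalars * T                                         ≡⟨ ∑-const scalars T ⟨
    ∑[ c ∈ scalars ] T                                         ≡⟨ ∑-cong scalars (λ c → sym (∑-translate d c (λ x → S x * E w x))) ⟩
    ∑[ c ∈ scalars ] ∑[ x ∈ points t ] S (x ⊕ c ⊙ d) * E w (x ⊕ c ⊙ d)
      ≡⟨ ∑-cong scalars (λ c → ∑-cong (points t) (λ x → cong₂ _*_ (inv c x) (slope c x))) ⟩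
    ∑[ c ∈ scalars ] ∑[ x ∈ points t ] S x * 𝟙 ((1ᶠ +ᶠ -ᶠ (w · x)) ≟ᶠ c)
      ≡⟨ ∑-swap scalars (points t) _ ⟩
    ∑[ x ∈ points t ] ∑[ c ∈ scalars ] S x * 𝟙 ((1ᶠ +ᶠ -ᶠ (w · x)) ≟ᶠ c)
      ≡⟨ ∑-cong (points t) (λ x → trans (∑-*ˡ scalars (S x) _)
           (trans (cong (S x *_) (∑-unique-≡1 _≟ᶠ_ scalars! (∈-scalars _))) (*-identityʳ (S x)))) ⟩
    ∑ (points t) S ∎
    where
    open ≡-Reasoning
    T = ∑[ x ∈ points t ] S x * E w x
    -- Translation by `c ⊙ d` raises the product with `w` by `c`, so it reaches 1 for the single
    -- value `c = 1 - w · x`.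
    slope : ∀ c x → E w (x ⊕ c ⊙ d) ≡ 𝟙 ((1ᶠ +ᶠ -ᶠ (w · x)) ≟ᶠ c)
    slope c x = trans
      (cong (λ a → 𝟙 (a ≟ᶠ 1ᶠ))
        (trans (·-lineʳ w x c d) (trans (cong (λ a → w · x +ᶠ c *ᶠ a) wd) (cong (w · x +ᶠ_) (R.*-identityʳ c)))))
      (𝟙-⇔ (_ ≟ᶠ _) (_ ≟ᶠ _)
        (λ e → trans (cong (_+ᶠ -ᶠ (w · x)) (trans (sym e) (R.+-comm _ c)))
                 (trans (R.+-assoc c _ _) (trans (cong (c +ᶠ_) (R.-‿inverseʳ _)) (R.+-identityʳ c))))
        (λ e → trans (cong (w · x +ᶠ_) (sym e)) (trans (R.+-comm _ _) (1-c+c (w · x)))))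

  solutions₁ : ∀ (w d : Pt t) → w · d ≡ 1ᶠ → q * ∑ (points t) (E w) ≡ q ^ t
  solutions₁ {t} w d wd = begin
    q * ∑ (points t) (E w)                 ≡⟨ cong (q *_) (∑-cong (points t) (λ x → sym (+-identityʳ (E w x)))) ⟩
    q * (∑[ x ∈ points t ] 1 * E w x)      ≡⟨ hyperplane-count w d (λ _ → 1) (λ _ _ → refl) wd ⟩
    ∑[ x ∈ points t ] 1                    ≡⟨ ∑-const (points t) 1 ⟩
    length (points t) * 1                  ≡⟨ *-identityʳ _ ⟩
    length (points t)                      ≡⟨ length-points t ⟩
    q ^ t                                  ∎
    where open ≡-Reasoning

  solutions₂ : ∀ (x y v : Pt t) → x · v ≡ 1ᶠ → y · v ≡ 1ᶠ → x ≢ y →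
               q * (q * (∑[ w ∈ points t ] E x w * E y w)) ≡ q ^ t
  solutions₂ x y v xv yv x≢y = let d , xd , yd = dual₂ x y v xv yv x≢y in
    trans (cong (q *_) (hyperplane-count y d (E x) (E-invariant x d xd) yd)) (solutions₁ x v xv)

  solutions₃ : ∀ (x y z v : Pt t) → x · v ≡ 1ᶠ → y · v ≡ 1ᶠ → z · v ≡ 1ᶠ →
               x ≢ y → (∀ c → z ≢ line x y c) →
               q * (q * (q * (∑[ w ∈ points t ] E x w * E y w * E z w))) ≡ q ^ t
  solutions₃ x y z v xv yv zv x≢y off = let d , xd , yd , zd = dual₃ x y z v xv yv zv x≢y off in
    trans (cong (λ m → q * (q * m)) (hyperplane-count z d (λ w → E x w * E y w)
            (λ c w → cong₂ _*_ (E-invariant x d xd c w) (E-invariant y d yd c w)) zd))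
          (solutions₂ x y v xv yv x≢y)

  -- Either the system has no solution, or any solution serves as the common neighbour that
  -- `solutions₂` asks for.
  solutions₂-≤ : ∀ {x y : Pt t} → x ≢ y → q * (q * (∑[ w ∈ points t ] E x w * E y w)) ≤ q ^ t
  solutions₂-≤ {t} {x} {y} x≢y with (∑[ w ∈ points t ] E x w * E y w) in eq
  ... | zero  = subst (_≤ q ^ t) (sym (trans (cong (q *_) (*-zeroʳ q)) (*-zeroʳ q))) z≤n
  ... | suc m =
    let v , _ , pos = ∑<∑⇒∃< (points t) {λ _ → 0} {λ w → E x w * E y w}
          (subst₂ _<_ (sym (trans (∑-const (points t) 0) (*-zeroʳ (length (points t))))) (sym eq) z<s)
        xv , yv = both (x · v ≟ᶠ 1ᶠ) (y · v ≟ᶠ 1ᶠ) pos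
    in ≤-reflexive (trans (cong (λ m → q * (q * m)) (sym eq)) (solutions₂ x y v xv yv x≢y))
    where
    both : ∀ {P Q : Set} (d : Dec P) (e : Dec Q) → 0 < 𝟙 d * 𝟙 e → P × Q
    both (yes p) (yes r) _ = p , r
    both (yes _) (no _)  ()
    both (no _)  _       ()

𝟙-×-dec : ∀ {P Q : Set} (d : Dec P) (e : Dec Q) → 𝟙 (d ×-dec e) ≡ 𝟙 d * 𝟙 e
𝟙-×-dec (yes _) (yes _) = refl
𝟙-×-dec (yes _) (no _)  = refl
𝟙-×-dec (no _)  _       = refl

-- Squared deviations in the natural numbers, and signs.

sqDist : ℕ → ℕ → ℕ
sqDist m n = ∣ m - n ∣ * ∣ m - n ∣

-- The binomial formula for the square of `m - n`, with the cross term moved across to avoid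
-- subtraction.
sqDist-expand : ∀ m n → m * m + n * n ≡ 2 * (m * n) + sqDist m n
sqDist-expand m n with ≤-total m n
... | inj₁ m≤n = begin
  m * m + n * n                              ≡⟨ cong (λ k → m * m + k * k) (m+[n∸m]≡n m≤n) ⟨
  m * m + (m + k) * (m + k)                  ≡⟨ square m k ⟩
  2 * (m * (m + k)) + k * k                  ≡⟨ cong₂ (λ a b → 2 * (m * a) + b * b) (m+[n∸m]≡n m≤n) (sym (m≤n⇒∣m-n∣≡n∸m m≤n)) ⟩
  2 * (m * n) + sqDist m n                   ∎
  where
  open ≡-Reasoning
  k = n ∸ m
  square : ∀ m k → m * m + (m + k) * (m + k) ≡ 2 * (m * (m + k)) + k * k
  square = solve-∀
... | inj₂ n≤m = begin
  m * m + n * n                              ≡⟨ cong (λ k → k * k + n * n) (m+[n∸m]≡n n≤m) ⟨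
  (n + k) * (n + k) + n * n                  ≡⟨ square n k ⟩
  2 * ((n + k) * n) + k * k                  ≡⟨ cong₂ (λ a b → 2 * (a * n) + b * b) (m+[n∸m]≡n n≤m) (sym (trans (∣-∣-comm m n) (m≤n⇒∣m-n∣≡n∸m n≤m))) ⟩
  2 * (m * n) + sqDist m n                   ∎
  where
  open ≡-Reasoning
  k = m ∸ n
  square : ∀ n k → (n + k) * (n + k) + n * n ≡ 2 * ((n + k) * n) + k * k
  square = solve-∀

Sign : Bool → Set → Set
Sign true  P = P
Sign false P = ¬ P

Sign⇒⇔ : ∀ {P} b → Sign b P → (P → b ≡ true) × (b ≡ true → P)
Sign⇒⇔ true  p  = (λ _ → refl) , (λ _ → p)
Sign⇒⇔ false ¬p = (λ p → contradiction p ¬p) , λ ()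

-- The variance of neighbour counts.

module Graph (F : FiniteField) {t : ℕ} where
  open FiniteField F using () renaming (1# to 1ᶠ; order to q)
  open Geometry F public
  open ≤-Reasoning

  Q : ℕ
  Q = q ^ t

  P : List (Pt t)
  P = points t

  -- The square is expanded, and twice `a * Q * a` is added to both sides in place of subtracting
  -- the cross term. Distinct pairs of `A` contribute at most `a * a * Q` to the second moment and
  -- the diagonal `a * (q * Q)`; only the latter survives the cancellation.
  variance : ∀ {A} → Unique A → All (_≢ zeroVec F) A →
             ∑[ y ∈ P ] sqDist (q * (∑[ w ∈ A ] E w y)) (length A) ≤ length A * (q * Q)
  variance {A} A! A≢0 = +-cancelʳ-≤ (2 * (a * Q * a)) _ _ (begin
    ∑sq + 2 * (a * Q * a)                            ≤⟨ +-monoʳ-≤ ∑sq (*-monoʳ-≤ 2 (*-monoˡ-≤ a first)) ⟩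
    ∑sq + 2 * ((∑[ y ∈ P ] q * N y) * a)             ≡⟨ cong (λ m → ∑sq + 2 * m) (∑-*ʳ P _ a) ⟨
    ∑sq + 2 * (∑[ y ∈ P ] q * N y * a)               ≡⟨ cong (∑sq +_) (∑-*ˡ P 2 _) ⟨
    ∑sq + (∑[ y ∈ P ] 2 * (q * N y * a))             ≡⟨ +-comm ∑sq _ ⟩
    (∑[ y ∈ P ] 2 * (q * N y * a)) + ∑sq             ≡⟨ ∑-+ P _ _ ⟨
    ∑[ y ∈ P ] 2 * (q * N y * a) + sqDist (q * N y) a ≡⟨ ∑-cong P (λ y → sqDist-expand (q * N y) a) ⟨
    ∑[ y ∈ P ] q * N y * (q * N y) + a * a           ≡⟨ ∑-+ P _ _ ⟩
    (∑[ y ∈ P ] q * N y * (q * N y)) + (∑[ y ∈ P ] a * a) ≤⟨ +-mono-≤ second (≤-reflexive (trans (∑-const P (a * a)) (cong (_* (a * a)) (length-points t)))) ⟩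
    a * (a * Q + q * Q) + Q * (a * a)                ≡⟨ rearrange a q Q ⟩
    a * (q * Q) + 2 * (a * Q * a)                    ∎)
    where
    a = length A
    N : Pt t → ℕ
    N y = ∑[ w ∈ A ] E w y
    ∑sq = ∑[ y ∈ P ] sqDist (q * N y) a
    rearrange : ∀ a q Q → a * (a * Q + q * Q) + Q * (a * a) ≡ a * (q * Q) + 2 * (a * Q * a)
    rearrange = solve-∀
    -- The cross term enters with a negative sign, so the first moment is bounded from below.
    first : a * Q ≤ ∑[ y ∈ P ] q * N y
    first = begin
      a * Q                                ≡⟨ ∑-const A Q ⟨
      ∑[ w ∈ A ] Q                         ≤⟨ ∑-mono-∈ A (λ {w} w∈ → let d , wd = dual₁ (All.lookup A≢0 w∈) in ≤-reflexive (sym (solutions₁ w d wd))) ⟩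
      ∑[ w ∈ A ] q * ∑ P (E w)             ≡⟨ ∑-*ˡ A q _ ⟩
      q * (∑[ w ∈ A ] ∑ P (E w))           ≡⟨ cong (q *_) (∑-swap A P E) ⟩
      q * ∑ P N                            ≡⟨ ∑-*ˡ P q N ⟨
      ∑[ y ∈ P ] q * N y                   ∎
    -- For `w = w′` the two equations coincide and define a hyperplane of `Q/q` points.
    pair : ∀ {w} → w ∈ A → ∀ w′ → q * (q * (∑[ y ∈ P ] E w y * E w′ y)) ≤ Q + 𝟙 (w ≟ₚ w′) * (q * Q)
    pair {w} w∈ w′ with w ≟ₚ w′
    ... | no w≢w′  = ≤-trans (solutions₂-≤ w≢w′) (m≤m+n Q 0)
    ... | yes refl = let d , wd = dual₁ (All.lookup A≢0 w∈) in begin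
      q * (q * (∑[ y ∈ P ] E w y * E w y))  ≡⟨ cong (λ m → q * (q * m)) (∑-cong P (λ y → 𝟙-idem (w · y ≟ᶠ 1ᶠ))) ⟩
      q * (q * ∑ P (E w))                   ≡⟨ cong (q *_) (solutions₁ w d wd) ⟩
      q * Q                                 ≡⟨ +-identityʳ _ ⟨
      1 * (q * Q)                           ≤⟨ m≤n+m _ Q ⟩
      Q + 1 * (q * Q)                       ∎
    regroup : ∀ q n → q * n * (q * n) ≡ q * q * (n * n)
    regroup = solve-∀
    second : ∑[ y ∈ P ] q * N y * (q * N y) ≤ a * (a * Q + q * Q)
    second = begin
      ∑[ y ∈ P ] q * N y * (q * N y)                                     ≡⟨ ∑-cong P (λ y → regroup q (N y)) ⟩
      ∑[ y ∈ P ] q * q * (N y * N y)                                     ≡⟨ ∑-*ˡ P (q * q) _ ⟩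
      q * q * (∑[ y ∈ P ] N y * N y)                                     ≡⟨ cong (q * q *_) (∑-cong P (λ y → ∑-product A A (λ w → E w y) (λ w → E w y))) ⟨
      q * q * (∑[ y ∈ P ] ∑[ w ∈ A ] ∑[ w′ ∈ A ] E w y * E w′ y)         ≡⟨ cong (q * q *_) (∑-swap P A _) ⟩
      q * q * (∑[ w ∈ A ] ∑[ y ∈ P ] ∑[ w′ ∈ A ] E w y * E w′ y)         ≡⟨ cong (q * q *_) (∑-cong A (λ w → ∑-swap P A _)) ⟩
      q * q * (∑[ w ∈ A ] ∑[ w′ ∈ A ] ∑[ y ∈ P ] E w y * E w′ y)         ≡⟨ ∑-*ˡ A (q * q) _ ⟨
      ∑[ w ∈ A ] q * q * (∑[ w′ ∈ A ] ∑[ y ∈ P ] E w y * E w′ y)         ≡⟨ ∑-cong A (λ w → ∑-*ˡ A (q * q) _) ⟨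
      ∑[ w ∈ A ] ∑[ w′ ∈ A ] q * q * (∑[ y ∈ P ] E w y * E w′ y)         ≤⟨ ∑-mono-∈ A (λ {w} w∈ → ∑-mono A (λ w′ → ≤-trans (≤-reflexive (*-assoc q q _)) (pair w∈ w′))) ⟩
      ∑[ w ∈ A ] ∑[ w′ ∈ A ] Q + 𝟙 (w ≟ₚ w′) * (q * Q)                   ≡⟨ ∑-cong A (λ w → trans (∑-+ A _ _) (cong₂ _+_ (∑-const A Q) (∑-*ʳ A _ (q * Q)))) ⟩
      ∑[ w ∈ A ] a * Q + (∑[ w′ ∈ A ] 𝟙 (w ≟ₚ w′)) * (q * Q)             ≤⟨ ∑-mono A (λ w → +-monoʳ-≤ (a * Q) (*-monoˡ-≤ (q * Q) (∑-unique-≤1 _≟ₚ_ A! w))) ⟩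
      ∑[ w ∈ A ] a * Q + 1 * (q * Q)                                     ≡⟨ ∑-const A _ ⟩
      a * (a * Q + 1 * (q * Q))                                          ≡⟨ cong (λ m → a * (a * Q + m)) (+-identityʳ _) ⟩
      a * (a * Q + q * Q)                                                ∎

  -- Shattering criteria, degrees and good vertices.

  module Vertices (U : List (Pt t)) (U! : Unique U) (U≢0 : All (_≢ zeroVec F) U) where

    n : ℕ
    n = length U

    ∑U≤∑P : ∀ f → ∑ U f ≤ ∑ P f
    ∑U≤∑P = ∑-⊆ _≟ₚ_ U! (λ _ → ∈-points _)

    n≤Q : n ≤ Q
    n≤Q = begin
      n                 ≡⟨ *-identityʳ n ⟨
      n * 1             ≡⟨ ∑-const U 1 ⟨
      (∑[ w ∈ U ] 1)    ≤⟨ ∑U≤∑P (λ _ → 1) ⟩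
      (∑[ w ∈ P ] 1)    ≡⟨ ∑-const P 1 ⟩
      length P * 1      ≡⟨ *-identityʳ _ ⟩
      length P          ≡⟨ length-points t ⟩
      Q                 ∎

    -- The patterns already imply that `x` and `y` are distinct: a vertex adjacent to exactly one of
    -- them tells them apart.
    shatter₂ : ∀ {x y} → x ∈ U → y ∈ U →
      (∀ a b → ∃ λ v → v ∈ U × Sign a (x · v ≡ 1ᶠ) × Sign b (y · v ≡ 1ᶠ)) → VCdim≥ F U 2
    shatter₂ {x} {y} x∈ y∈ pattern′ = x ∷ y ∷ [] , (x≢y ∷ []) ∷ [] ∷ [] , refl , x∈ ∷ y∈ ∷ [] ,
      λ f → let v , v∈ , sx , sy = pattern′ (f zero) (f (suc zero)) in
        v , v∈ , λ { zero → Sign⇒⇔ (f zero) sx ; (suc zero) → Sign⇒⇔ (f (suc zero)) sy }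
      where
      x≢y : x ≢ y
      x≢y refl = let _ , _ , xv , ¬xv = pattern′ true false in ¬xv xv

    shatter₃ : ∀ {x y z} → x ∈ U → y ∈ U → z ∈ U →
      (∀ a b c → ∃ λ v → v ∈ U × Sign a (x · v ≡ 1ᶠ) × Sign b (y · v ≡ 1ᶠ) × Sign c (z · v ≡ 1ᶠ)) →
      VCdim≥ F U 3
    shatter₃ {x} {y} {z} x∈ y∈ z∈ pattern′ = x ∷ y ∷ z ∷ [] ,
      (x≢y ∷ x≢z ∷ []) ∷ (y≢z ∷ []) ∷ [] ∷ [] , refl , x∈ ∷ y∈ ∷ z∈ ∷ [] ,
      λ f → let v , v∈ , sx , sy , sz = pattern′ (f zero) (f (suc zero)) (f (suc (suc zero))) in
        v , v∈ , λ { zero → Sign⇒⇔ (f zero) sx ; (suc zero) → Sign⇒⇔ (f (suc zero)) sy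
                   ; (suc (suc zero)) → Sign⇒⇔ (f (suc (suc zero))) sz }
      where
      x≢y : x ≢ y
      x≢y refl = let _ , _ , xv , ¬xv , _ = pattern′ true false true in ¬xv xv
      x≢z : x ≢ z
      x≢z refl = let _ , _ , xv , _ , ¬xv = pattern′ true false false in ¬xv xv
      y≢z : y ≢ z
      y≢z refl = let _ , _ , _ , yv , ¬yv = pattern′ true true false in ¬yv yv

    D : Pt t → ℕ
    D x = ∑[ w ∈ U ] E x w

    -- The degree is at least a quarter of its expected value `n/q`, and below `n/2`, so that two
    -- good vertices always leave a vertex of `U` adjacent to neither.
    Good : Pt t → Set
    Good x = n ≤ 4 * (q * D x) × 2 * D x < n

    good? : Decidable Good
    good? x = n ≤? 4 * (q * D x) ×-dec 2 * D x <? n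

    GoodNeighbour : Pt t → Pt t → Set
    GoodNeighbour v x = Good x × x · v ≡ 1ᶠ

    goodNeighbour? : ∀ v → Decidable (GoodNeighbour v)
    goodNeighbour? v x = good? x ×-dec x · v ≟ᶠ 1ᶠ

    A : Pt t → List (Pt t)
    A v = filter (goodNeighbour? v) U

    A! : ∀ v → Unique (A v)
    A! v = Unique.filter⁺ (goodNeighbour? v) U!

    ∈A⁻ : ∀ {v x} → x ∈ A v → x ∈ U × Good x × x · v ≡ 1ᶠ
    ∈A⁻ {v} = ∈-filter⁻ (goodNeighbour? v)

    A≢0 : ∀ v → All (_≢ zeroVec F) (A v)
    A≢0 v = All.tabulate (λ x∈ → All.lookup U≢0 (proj₁ (∈A⁻ {v} x∈)))

    ∑-A : ∀ v h → ∑ (A v) h ≡ ∑[ x ∈ U ] 𝟙 (good? x) * E x v * h x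
    ∑-A v h = trans (∑-filter (goodNeighbour? v) U h)
      (∑-cong U (λ x → cong (_* h x) (𝟙-×-dec (good? x) (x · v ≟ᶠ 1ᶠ))))

    ∑-A-≤ : ∀ v h → ∑ (A v) h ≤ ∑[ x ∈ U ] E x v * h x
    ∑-A-≤ v h = begin
      ∑ (A v) h                                ≡⟨ ∑-A v h ⟩
      ∑[ x ∈ U ] 𝟙 (good? x) * E x v * h x     ≤⟨ ∑-mono U (λ x → *-monoˡ-≤ (h x) (*-monoˡ-≤ (E x v) (𝟙≤1 (good? x)))) ⟩
      ∑[ x ∈ U ] 1 * E x v * h x               ≡⟨ ∑-cong U (λ x → cong (_* h x) (+-identityʳ (E x v))) ⟩
      ∑[ x ∈ U ] E x v * h x                   ∎

    ∑-length-A : ∑[ v ∈ U ] length (A v) ≡ ∑[ x ∈ U ] 𝟙 (good? x) * D x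
    ∑-length-A = begin-equality
      ∑[ v ∈ U ] length (A v)                             ≡⟨ ∑-cong U (λ v → trans (sym (*-identityʳ _)) (sym (∑-const (A v) 1))) ⟩
      ∑[ v ∈ U ] ∑[ x ∈ A v ] 1                           ≡⟨ ∑-cong U (λ v → ∑-A v (λ _ → 1)) ⟩
      ∑[ v ∈ U ] ∑[ x ∈ U ] 𝟙 (good? x) * E x v * 1       ≡⟨ ∑-cong U (λ v → ∑-cong U (λ x → *-identityʳ _)) ⟩
      ∑[ v ∈ U ] ∑[ x ∈ U ] 𝟙 (good? x) * E x v           ≡⟨ ∑-swap U U _ ⟩
      ∑[ x ∈ U ] ∑[ v ∈ U ] 𝟙 (good? x) * E x v           ≡⟨ ∑-cong U (λ x → ∑-*ˡ U (𝟙 (good? x)) _) ⟩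
      ∑[ x ∈ U ] 𝟙 (good? x) * D x                        ∎

    -- Good vertices carry many edges.

    module _ (4≤q : 4 ≤ q) (0<n : 0 < n) where

      private instance
        n≢0 : NonZero n
        n≢0 = >-nonZero 0<n

      -- For a good vertex this is the binomial formula. For any other vertex the deviation of
      -- `q * D x` from `n` pays alone: it is at least `3n/4` if the degree is too small, and at
      -- least `n` if it is too large, as then `q * D x` is at least `2n`.
      degree-tradeoff : ∀ x → n * n ≤ 2 * (n * (q * (𝟙 (good? x) * D x))) + 2 * sqDist (q * D x) n
      degree-tradeoff x with n ≤? 4 * (q * D x) | 2 * D x <? n
      ... | yes _ | yes _ = begin
        n * n                                   ≤⟨ m≤n+m _ (u * u) ⟩
        u * u + n * n                           ≡⟨ sqDist-expand u n ⟩
        2 * (u * n) + s                         ≤⟨ +-mono-≤ (≤-reflexive (cong (2 *_) (trans (*-comm u n) (cong (λ m → n * (q * m)) (sym (+-identityʳ (D x))))))) (m≤m+n s _) ⟩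
        2 * (n * (q * (1 * D x))) + 2 * s       ∎
        where
        u = q * D x
        s = sqDist u n
      ... | no n≰4u | _ = ≤-trans (*-cancelˡ-≤ {n * n} {2 * (r * r)} 16 (begin
        16 * (n * n)                        ≤⟨ *-monoˡ-≤ (n * n) (m≤m+n 16 2) ⟩
        18 * (n * n)                        ≡⟨ split n ⟩
        2 * ((3 * n) * (3 * n))             ≤⟨ *-monoʳ-≤ 2 (*-mono-≤ 3n≤4r 3n≤4r) ⟩
        2 * ((4 * r) * (4 * r))             ≡⟨ merge r ⟩
        16 * (2 * (r * r))                  ∎)) (m≤n+m (2 * (r * r)) (2 * (n * (q * 0))))
        where
        u = q * D x
        r = ∣ u - n ∣
        split : ∀ n → 18 * (n * n) ≡ 2 * ((3 * n) * (3 * n))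
        split = solve-∀
        merge : ∀ r → 2 * ((4 * r) * (4 * r)) ≡ 16 * (2 * (r * r))
        merge = solve-∀
        3n≤4r : 3 * n ≤ 4 * r
        3n≤4r = +-cancelˡ-≤ n _ _ (begin
          4 * n              ≤⟨ *-monoʳ-≤ 4 (m≤n+∣n-m∣ n u) ⟩
          4 * (u + r)        ≡⟨ *-distribˡ-+ 4 u r ⟩
          4 * u + 4 * r      ≤⟨ +-monoˡ-≤ (4 * r) (≰⇒≥ n≰4u) ⟩
          n + 4 * r          ∎)
      ... | yes _ | no 2D≮n = ≤-trans (begin
        n * n                  ≤⟨ *-mono-≤ n≤r n≤r ⟩
        r * r                  ≤⟨ m≤m+n _ _ ⟩
        2 * (r * r)            ∎) (m≤n+m (2 * (r * r)) (2 * (n * (q * 0))))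
        where
        u = q * D x
        r = ∣ u - n ∣
        n≤r : n ≤ r
        n≤r = +-cancelˡ-≤ n _ _ (begin
          n + n                ≡⟨ cong (n +_) (+-identityʳ n) ⟨
          2 * n                ≤⟨ *-monoʳ-≤ 2 (≮⇒≥ 2D≮n) ⟩
          2 * (2 * D x)        ≡⟨ *-assoc 2 2 (D x) ⟨
          4 * D x              ≤⟨ *-monoˡ-≤ (D x) 4≤q ⟩
          u                    ≤⟨ m≤n+∣m-n∣ u n ⟩
          n + r                ∎)

      -- Twice `degree-tradeoff`, summed over `U`, has `2n³` on the left. By the variance bound and
      -- the hypothesis the deviations account for at most `n³` of it, which leaves `n³` for the
      -- edges at good vertices.
      many-good-edges : 4 * (q * Q) ≤ n * n → n * n ≤ ∑[ v ∈ U ] 4 * (q * length (A v))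
      many-good-edges 4qQ≤nn = *-cancelˡ-≤ n (+-cancelʳ-≤ (n * (n * n)) _ _ (begin
        n * (n * n) + n * (n * n)                          ≡⟨ double (n * (n * n)) ⟩
        2 * (n * (n * n))                                  ≡⟨ cong (2 *_) (∑-const U (n * n)) ⟨
        2 * (∑[ x ∈ U ] n * n)                             ≤⟨ *-monoʳ-≤ 2 (∑-mono U degree-tradeoff) ⟩
        2 * (∑[ x ∈ U ] 2 * (n * (q * (𝟙 (good? x) * D x))) + 2 * sqDist (q * D x) n) ≡⟨ cong (2 *_) (∑-+ U _ _) ⟩
        2 * ((∑[ x ∈ U ] 2 * (n * (q * (𝟙 (good? x) * D x)))) + (∑[ x ∈ U ] 2 * sqDist (q * D x) n))
          ≡⟨ cong₂ (λ a b → 2 * (a + b)) gather (∑-*ˡ U 2 _) ⟩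
        2 * (2 * (n * (q * e)) + 2 * (∑[ x ∈ U ] sqDist (q * D x) n)) ≤⟨ *-monoʳ-≤ 2 (+-monoʳ-≤ (2 * (n * (q * e))) (*-monoʳ-≤ 2 spread)) ⟩
        2 * (2 * (n * (q * e)) + 2 * (n * (q * Q)))        ≡⟨ expand n (q * e) (q * Q) ⟩
        n * (4 * (q * e)) + n * (4 * (q * Q))              ≤⟨ +-monoʳ-≤ (n * (4 * (q * e))) (*-monoʳ-≤ n 4qQ≤nn) ⟩
        n * (4 * (q * e)) + n * (n * n)                    ≡⟨ cong (λ m → n * m + n * (n * n)) total ⟩
        n * (∑[ v ∈ U ] 4 * (q * length (A v))) + n * (n * n) ∎))
        where
        e = ∑[ x ∈ U ] 𝟙 (good? x) * D x
        double : ∀ m → m + m ≡ 2 * m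
        double = solve-∀
        expand : ∀ n a b → 2 * (2 * (n * a) + 2 * (n * b)) ≡ n * (4 * a) + n * (4 * b)
        expand = solve-∀
        gather : ∑[ x ∈ U ] 2 * (n * (q * (𝟙 (good? x) * D x))) ≡ 2 * (n * (q * e))
        gather = trans (∑-*ˡ U 2 _) (cong (2 *_) (trans (∑-*ˡ U n _) (cong (n *_) (∑-*ˡ U q _))))
        total : 4 * (q * e) ≡ ∑[ v ∈ U ] 4 * (q * length (A v))
        total = sym (trans (∑-*ˡ U 4 _) (cong (4 *_) (trans (∑-*ˡ U q _) (cong (q *_) ∑-length-A))))
        spread : ∑[ x ∈ U ] sqDist (q * D x) n ≤ n * (q * Q)
        spread = begin
          ∑[ x ∈ U ] sqDist (q * D x) n                       ≤⟨ ∑U≤∑P _ ⟩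
          ∑[ x ∈ P ] sqDist (q * D x) n                       ≡⟨ ∑-cong P (λ x → cong (λ m → sqDist (q * m) n) (∑-cong U (λ w → E-sym x w))) ⟩
          ∑[ x ∈ P ] sqDist (q * (∑[ w ∈ U ] E w x)) n        ≤⟨ variance U! U≢0 ⟩
          n * (q * Q)                                         ∎

      -- Dimension 2.

      vc≥2 : 65 * (q * Q) ≤ n * n → VCdim≥ F U 2
      vc≥2 65qQ≤nn =
        let v , v∈ , n≤4qa = ∑≤∑⇒∃≤ U {λ _ → n} {λ v → 4 * (q * length (A v))} 0<n
              (≤-trans (≤-reflexive (∑-const U n)) (many-good-edges (≤-trans (*-monoˡ-≤ (q * Q) (m≤m+n 4 61)) 65qQ≤nn)))
            0<a = positive-length v n≤4qa
            x₀ , x₀∈A , min = ∃-minimum D (A v) 0<a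
            x₀∈ , (n≤4qb , 2D₀<n) , x₀v = ∈A⁻ {v} x₀∈A
            w , w∈ , x₀w , x , x∈A , ¬xw = missing-edge v x₀ n≤4qa 0<a n≤4qb
            x∈ , (_ , 2D<n) , xv = ∈A⁻ {v} x∈A
            w′ , w′∈ , xw′ , ¬x₀w′ = reverse-difference x₀ x w (min x∈A) w∈ x₀w ¬xw
            u , u∈ , ¬x₀u , ¬xu = neither x₀ x 2D₀<n 2D<n
        in shatter₂ x₀∈ x∈ λ where
             true  true  → v , v∈ , x₀v , xv
             true  false → w , w∈ , x₀w , ¬xw
             false true  → w′ , w′∈ , ¬x₀w′ , xw′
             false false → u , u∈ , ¬x₀u , ¬xu
        where
        positive-length : ∀ v → n ≤ 4 * (q * length (A v)) → 0 < length (A v)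
        positive-length v le with length (A v)
        ... | suc _ = z<s
        ... | zero  = contradiction (≤-trans 0<n (≤-trans le (≤-reflexive (cong (4 *_) (*-zeroʳ q))))) λ ()

        -- Otherwise the neighbourhood of x₀ and A v span a complete bipartite graph, too dense for the variance bound.
        missing-edge : ∀ v x₀ → n ≤ 4 * (q * length (A v)) → 0 < length (A v) → n ≤ 4 * (q * D x₀) →
                       ∃ λ w → w ∈ U × x₀ · w ≡ 1ᶠ × ∃ λ x → x ∈ A v × ¬ (x · w ≡ 1ᶠ)
        missing-edge v x₀ n≤4qa 0<a n≤4qb =
          -- The weight `E x₀ w` makes both sides vanish off the neighbourhood of `x₀`. Strictness
          -- therefore gives a neighbour of `x₀` whose deviation is not that of a vertex adjacent to
          -- all of `A v`.
          let w , w∈ , lt = ∑<∑⇒∃< U {λ w → E x₀ w * sqDist (q * N w) a} {λ w → E x₀ w * sqDist (q * a) a} exceeds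
              x₀w , lt′ = decode (x₀ · w ≟ᶠ 1ᶠ) lt
              x , x∈ , lt″ = ∑<∑⇒∃< (A v) {λ x → E x w} {λ _ → 1} (≤∧≢⇒< (all-but w) (not-all w lt′))
          in w , w∈ , x₀w , x , x∈ , 𝟙<1⇒¬ (x · w ≟ᶠ 1ᶠ) lt″
          where
          a = length (A v)
          b = D x₀
          N : Pt t → ℕ
          N w = ∑[ x ∈ A v ] E x w
          r = ∣ q * a - a ∣
          decode : ∀ {P : Set} (d : Dec P) {m k} → 𝟙 d * m < 𝟙 d * k → P × m < k
          decode (yes p) lt = p , subst₂ _<_ (+-identityʳ _) (+-identityʳ _) lt
          decode (no _) ()
          ∑1 : ∑[ x ∈ A v ] 1 ≡ a
          ∑1 = trans (∑-const (A v) 1) (*-identityʳ a)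
          all-but : ∀ w → N w ≤ ∑[ x ∈ A v ] 1
          all-but w = ∑-mono (A v) (λ x → 𝟙≤1 (x · w ≟ᶠ 1ᶠ))
          not-all : ∀ w → sqDist (q * N w) a < sqDist (q * a) a → N w ≢ ∑[ x ∈ A v ] 1
          not-all w lt eq = <⇒≢ lt (cong (λ m → sqDist (q * m) a) (trans eq ∑1))
          qa≤2r : q * a ≤ 2 * r
          qa≤2r = +-cancelˡ-≤ (q * a) _ _ (begin
            q * a + q * a            ≤⟨ +-mono-≤ (m≤n+∣m-n∣ (q * a) a) (m≤n+∣m-n∣ (q * a) a) ⟩
            (a + r) + (a + r)        ≡⟨ collect a r ⟩
            2 * a + 2 * r            ≤⟨ +-monoˡ-≤ (2 * r) (*-monoˡ-≤ a (≤-trans (m≤m+n 2 2) 4≤q)) ⟩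
            q * a + 2 * r            ∎)
            where
            collect : ∀ a r → (a + r) + (a + r) ≡ 2 * a + 2 * r
            collect = solve-∀
          dense : a * (q * Q) < b * (r * r)
          -- Two bounds with factor 4 on `n` and the squared factor 2 of `qa≤2r` give 64; the
          -- constant 65 leaves room for strictness.
          dense = *-cancelˡ-< 64 _ _ (begin-strict
            64 * (a * (q * Q))                       <⟨ *-monoˡ-< (a * (q * Q)) (n<1+n 64) ⟩
            65 * (a * (q * Q))                       ≡⟨ swap a (q * Q) ⟩
            a * (65 * (q * Q))                       ≤⟨ *-monoʳ-≤ a 65qQ≤nn ⟩
            a * (n * n)                              ≤⟨ *-monoʳ-≤ a (*-mono-≤ n≤4qa n≤4qb) ⟩
            a * (4 * (q * a) * (4 * (q * b)))        ≡⟨ arrange a q b ⟩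
            16 * (b * (q * a * (q * a)))             ≤⟨ *-monoʳ-≤ 16 (*-monoʳ-≤ b (*-mono-≤ qa≤2r qa≤2r)) ⟩
            16 * (b * (2 * r * (2 * r)))             ≡⟨ collect b r ⟩
            64 * (b * (r * r))                       ∎)
            where
            instance
              a≢0 : NonZero a
              a≢0 = >-nonZero 0<a
              prod≢0 : NonZero (a * (q * Q))
              prod≢0 = m*n≢0 a (q * Q) {{a≢0}} {{m*n≢0 q Q {{q≢0}} {{m^n≢0 q t}}}}
            swap : ∀ a m → 65 * (a * m) ≡ a * (65 * m)
            swap = solve-∀
            arrange : ∀ a q b → a * (4 * (q * a) * (4 * (q * b))) ≡ 16 * (b * (q * a * (q * a)))
            arrange = solve-∀
            collect : ∀ b r → 16 * (b * (2 * r * (2 * r))) ≡ 64 * (b * (r * r))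
            collect = solve-∀
          exceeds : ∑[ w ∈ U ] E x₀ w * sqDist (q * N w) a < ∑[ w ∈ U ] E x₀ w * sqDist (q * a) a
          exceeds = begin-strict
            ∑[ w ∈ U ] E x₀ w * sqDist (q * N w) a   ≤⟨ ∑-mono U (λ w → *-monoˡ-≤ (sqDist (q * N w) a) (𝟙≤1 (x₀ · w ≟ᶠ 1ᶠ))) ⟩
            ∑[ w ∈ U ] 1 * sqDist (q * N w) a        ≡⟨ ∑-cong U (λ w → +-identityʳ _) ⟩
            ∑[ w ∈ U ] sqDist (q * N w) a            ≤⟨ ∑U≤∑P _ ⟩
            ∑[ w ∈ P ] sqDist (q * N w) a            ≤⟨ variance (A! v) (A≢0 v) ⟩
            a * (q * Q)                              <⟨ dense ⟩
            b * (r * r)                              ≡⟨ ∑-*ʳ U (E x₀) (r * r) ⟨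
            ∑[ w ∈ U ] E x₀ w * sqDist (q * a) a     ∎

        -- Since `w` is missed by `x`, the common neighbours are fewer than `D x₀`, hence fewer than
        -- `D x`.
        reverse-difference : ∀ x₀ x w → D x₀ ≤ D x → w ∈ U → x₀ · w ≡ 1ᶠ → ¬ (x · w ≡ 1ᶠ) →
                             ∃ λ w′ → w′ ∈ U × x · w′ ≡ 1ᶠ × ¬ (x₀ · w′ ≡ 1ᶠ)
        reverse-difference x₀ x w D₀≤D w∈ x₀w ¬xw =
          let w′ , w′∈ , lt = ∑<∑⇒∃< U {λ w → E x w * E x₀ w} {λ w → E x w} (<-≤-trans
                (∑-mono-< U (λ w → ≤-trans (*-monoˡ-≤ (E x₀ w) (𝟙≤1 (x · w ≟ᶠ 1ᶠ))) (≤-reflexive (+-identityʳ _)))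
                  w∈ (subst₂ (λ m k → m * E x₀ w < k) (sym (𝟙-false (x · w ≟ᶠ 1ᶠ) ¬xw)) (sym (𝟙-true (x₀ · w ≟ᶠ 1ᶠ) x₀w)) z<s))
                D₀≤D)
          in w′ , w′∈ , decode (x · w′ ≟ᶠ 1ᶠ) (x₀ · w′ ≟ᶠ 1ᶠ) lt
          where
          decode : ∀ {P R : Set} (d : Dec P) (e : Dec R) → 𝟙 d * 𝟙 e < 𝟙 d → P × ¬ R
          decode (yes p) (no ¬r) _ = p , ¬r
          decode (yes _) (yes _) (s≤s ())
          decode (no _)  _       ()

        neither : ∀ x y → 2 * D x < n → 2 * D y < n → ∃ λ w → w ∈ U × ¬ (x · w ≡ 1ᶠ) × ¬ (y · w ≡ 1ᶠ)
        neither x y 2Dx<n 2Dy<n =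
          let w , w∈ , lt = ∑<∑⇒∃< U {λ w → E x w + E y w} {λ _ → 1} (*-cancelˡ-< 2 _ _ (begin-strict
                2 * (∑[ w ∈ U ] E x w + E y w)   ≡⟨ cong (2 *_) (∑-+ U _ _) ⟩
                2 * (D x + D y)                  ≡⟨ *-distribˡ-+ 2 (D x) (D y) ⟩
                2 * D x + 2 * D y                <⟨ +-mono-< 2Dx<n 2Dy<n ⟩
                n + n                            ≡⟨ cong (n +_) (+-identityʳ n) ⟨
                2 * n                            ≡⟨ cong (2 *_) (trans (∑-const U 1) (*-identityʳ n)) ⟨
                2 * (∑[ w ∈ U ] 1)               ∎))
          in w , w∈ , 𝟙<1⇒¬ (x · w ≟ᶠ 1ᶠ) (≤-<-trans (m≤m+n _ _) lt) , 𝟙<1⇒¬ (y · w ≟ᶠ 1ᶠ) (≤-<-trans (m≤n+m _ (E x w)) lt)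

      -- Dimension 3: pairs with few common neighbours.

      codeg : Pt t → Pt t → ℕ
      codeg x y = ∑[ w ∈ U ] E x w * E y w

      -- The threshold `Q/q³` is the number of common neighbours, among all points, of three
      -- non-collinear points that have one. A pair above it has a common neighbour in `U` that the
      -- third point misses.
      sparse? : ∀ x y → Dec (q * (q * (q * codeg x y)) ≤ Q)
      sparse? x y = q * (q * (q * codeg x y)) ≤? Q

      sparsePairs : Pt t → ℕ
      sparsePairs v = ∑[ x ∈ A v ] ∑[ y ∈ A v ] 𝟙 (sparse? x y)

      -- After exchanging the sums, an ordered sparse pair is counted at most once for each common
      -- neighbour, hence at most `Q/q³` times, and there are at most `n * n` pairs.
      ∑-sparsePairs : q * (q * (q * ∑ U sparsePairs)) ≤ n * (n * Q)
      ∑-sparsePairs = begin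
        q * (q * (q * ∑ U sparsePairs))                ≤⟨ *-monoʳ-≤ q (*-monoʳ-≤ q (*-monoʳ-≤ q (∑-mono U inflate))) ⟩
        q * (q * (q * (∑[ v ∈ U ] ∑[ x ∈ U ] ∑[ y ∈ U ] E x v * E y v * 𝟙 (sparse? x y)))) ≡⟨ cong (λ m → q * (q * (q * m))) reorder ⟩
        q * (q * (q * (∑[ x ∈ U ] ∑[ y ∈ U ] codeg x y * 𝟙 (sparse? x y)))) ≡⟨ pull ⟩
        ∑[ x ∈ U ] ∑[ y ∈ U ] q * (q * (q * (codeg x y * 𝟙 (sparse? x y)))) ≤⟨ ∑-mono U (λ x → ∑-mono U (λ y → capped (sparse? x y))) ⟩
        ∑[ x ∈ U ] ∑[ y ∈ U ] Q                        ≡⟨ ∑-cong U (λ x → ∑-const U Q) ⟩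
        ∑[ x ∈ U ] n * Q                               ≡⟨ ∑-const U (n * Q) ⟩
        n * (n * Q)                                    ∎
        where
        -- Dropping the goodness condition turns the ranges that depend on `v` into weights, so the
        -- sums can be exchanged.
        inflate : ∀ v → sparsePairs v ≤ ∑[ x ∈ U ] ∑[ y ∈ U ] E x v * E y v * 𝟙 (sparse? x y)
        inflate v = begin
          sparsePairs v                                                   ≤⟨ ∑-mono (A v) (λ x → ∑-A-≤ v (λ y → 𝟙 (sparse? x y))) ⟩
          ∑[ x ∈ A v ] ∑[ y ∈ U ] E y v * 𝟙 (sparse? x y)                 ≤⟨ ∑-A-≤ v (λ x → ∑[ y ∈ U ] E y v * 𝟙 (sparse? x y)) ⟩
          ∑[ x ∈ U ] E x v * (∑[ y ∈ U ] E y v * 𝟙 (sparse? x y))         ≡⟨ ∑-cong U (λ x → ∑-*ˡ U (E x v) _) ⟨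
          ∑[ x ∈ U ] ∑[ y ∈ U ] E x v * (E y v * 𝟙 (sparse? x y))         ≡⟨ ∑-cong U (λ x → ∑-cong U (λ y → *-assoc (E x v) (E y v) _)) ⟨
          ∑[ x ∈ U ] ∑[ y ∈ U ] E x v * E y v * 𝟙 (sparse? x y)           ∎
        reorder : ∑[ v ∈ U ] ∑[ x ∈ U ] ∑[ y ∈ U ] E x v * E y v * 𝟙 (sparse? x y) ≡
                  ∑[ x ∈ U ] ∑[ y ∈ U ] codeg x y * 𝟙 (sparse? x y)
        reorder = trans (∑-swap U U _) (∑-cong U (λ x → trans (∑-swap U U _)
          (∑-cong U (λ y → ∑-*ʳ U (λ v → E x v * E y v) (𝟙 (sparse? x y))))))
        pull-one : ∀ (f : Pt t → Pt t → ℕ) → q * (∑[ x ∈ U ] ∑[ y ∈ U ] f x y) ≡ ∑[ x ∈ U ] ∑[ y ∈ U ] q * f x y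
        pull-one f = sym (trans (∑-cong U (λ x → ∑-*ˡ U q (f x))) (∑-*ˡ U q (λ x → ∑ U (f x))))
        pull : q * (q * (q * (∑[ x ∈ U ] ∑[ y ∈ U ] codeg x y * 𝟙 (sparse? x y)))) ≡
               ∑[ x ∈ U ] ∑[ y ∈ U ] q * (q * (q * (codeg x y * 𝟙 (sparse? x y))))
        pull = trans (cong (λ m → q * (q * m)) (pull-one _)) (trans (cong (q *_) (pull-one _)) (pull-one _))
        capped : ∀ {c} (d : Dec (q * (q * (q * c)) ≤ Q)) → q * (q * (q * (c * 𝟙 d))) ≤ Q
        capped {c} (yes le) = ≤-trans (≤-reflexive (cong (λ m → q * (q * (q * m))) (*-identityʳ c))) le
        capped {c} (no _)   = ≤-trans (≤-reflexive (zeros q c)) z≤n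
          where
          zeros : ∀ q c → q * (q * (q * (c * 0))) ≡ 0
          zeros = solve-∀

      -- Cauchy-Schwarz in the form `h² + n² ≥ 2hn`, where `h` has mean at least `n` by
      -- `many-good-edges`.
      ∑-degree² : 4 * (q * Q) ≤ n * n → n * (n * n) ≤ ∑[ v ∈ U ] 4 * (q * length (A v)) * (4 * (q * length (A v)))
      ∑-degree² 4qQ≤nn = +-cancelʳ-≤ (n * (n * n)) _ _ (begin
        n * (n * n) + n * (n * n)                           ≡⟨ double n (n * n) ⟩
        2 * (n * n * n)                                     ≤⟨ *-monoʳ-≤ 2 (*-monoˡ-≤ n (many-good-edges 4qQ≤nn)) ⟩
        2 * (∑ U h * n)                                     ≡⟨ cong (2 *_) (∑-*ʳ U h n) ⟨
        2 * (∑[ v ∈ U ] h v * n)                            ≡⟨ ∑-*ˡ U 2 _ ⟨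
        ∑[ v ∈ U ] 2 * (h v * n)                            ≤⟨ ∑-mono U (λ v → m≤m+n _ (sqDist (h v) n)) ⟩
        ∑[ v ∈ U ] 2 * (h v * n) + sqDist (h v) n           ≡⟨ ∑-cong U (λ v → sqDist-expand (h v) n) ⟨
        ∑[ v ∈ U ] h v * h v + n * n                        ≡⟨ ∑-+ U _ _ ⟩
        (∑[ v ∈ U ] h v * h v) + (∑[ v ∈ U ] n * n)         ≡⟨ cong ((∑[ v ∈ U ] h v * h v) +_) (∑-const U (n * n)) ⟩
        (∑[ v ∈ U ] h v * h v) + n * (n * n)                ∎)
        where
        h : Pt t → ℕ
        h v = 4 * (q * length (A v))
        double : ∀ n m → n * m + n * m ≡ 2 * (m * n)
        double = solve-∀

      -- The second bound makes sparse pairs rare and leaves room for the smaller adjacency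
      -- patterns; the third makes some `A v` long compared with a line.
      module _ (4qQ≤nn : 4 * (q * Q) ≤ n * n) (640Q≤qn : 640 * Q ≤ q * n) (32qq≤n : 32 * (q * q) ≤ n) where

        -- One inequality carries two facts about the same `v`: sparse pairs are few in `A v`, and,
        -- through the summand `n * n`, the list `A v` is long. Each term on the left sums to at
        -- most `n³`, the right side to at least `4n³`.
        rich-vertex : ∃ λ v → v ∈ U ×
          640 * (q * (q * sparsePairs v)) + n * n < 4 * (4 * (q * length (A v)) * (4 * (q * length (A v))))
        rich-vertex = ∑<∑⇒∃< U (begin-strict
          ∑[ v ∈ U ] 640 * (q * (q * sparsePairs v)) + n * n    ≡⟨ trans (∑-+ U _ _) (cong₂ _+_ pull (∑-const U (n * n))) ⟩
          640 * (q * (q * ∑ U sparsePairs)) + n * (n * n)       ≤⟨ +-monoˡ-≤ (n * (n * n)) few ⟩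
          n * (n * n) + n * (n * n)                             <⟨ more (n * (n * n)) {{m*n≢0 n (n * n) {{n≢0}} {{m*n≢0 n n}}}} ⟩
          4 * (n * (n * n))                                     ≤⟨ *-monoʳ-≤ 4 (∑-degree² 4qQ≤nn) ⟩
          4 * (∑[ v ∈ U ] 4 * (q * length (A v)) * (4 * (q * length (A v)))) ≡⟨ ∑-*ˡ U 4 _ ⟨
          ∑[ v ∈ U ] 4 * (4 * (q * length (A v)) * (4 * (q * length (A v)))) ∎)
          where
          pull : ∑[ v ∈ U ] 640 * (q * (q * sparsePairs v)) ≡ 640 * (q * (q * ∑ U sparsePairs))
          pull = trans (∑-*ˡ U 640 _) (cong (640 *_) (trans (∑-*ˡ U q _) (cong (q *_) (∑-*ˡ U q sparsePairs))))
          more : ∀ m .{{_ : NonZero m}} → m + m < 4 * m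
          more m = <-≤-trans (m<m+n (m + m) (>-nonZero⁻¹ m)) (≤-trans (m≤m+n _ m) (≤-reflexive (four m)))
            where
            four : ∀ m → m + m + m + m ≡ 4 * m
            four = solve-∀
          few : 640 * (q * (q * ∑ U sparsePairs)) ≤ n * (n * n)
          few = *-cancelˡ-≤ q (begin
            q * (640 * (q * (q * ∑ U sparsePairs)))   ≡⟨ *-left-comm q 640 _ ⟩
            640 * (q * (q * (q * ∑ U sparsePairs)))   ≤⟨ *-monoʳ-≤ 640 ∑-sparsePairs ⟩
            640 * (n * (n * Q))                       ≡⟨ trans (*-left-comm 640 n _) (cong (n *_) (*-left-comm 640 n Q)) ⟩
            n * (n * (640 * Q))                       ≤⟨ *-monoʳ-≤ n (*-monoʳ-≤ n 640Q≤qn) ⟩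
            n * (n * (q * n))                         ≡⟨ trans (cong (n *_) (*-left-comm n q n)) (*-left-comm n q _) ⟩
            q * (n * (n * n))                         ∎)
            where
            *-left-comm : ∀ a b c → a * (b * c) ≡ b * (a * c)
            *-left-comm a b c = trans (sym (*-assoc a b c)) (trans (cong (_* c) (*-comm a b)) (*-assoc b a c))

        -- A triple in general position without sparse pairs.

        collinear : Pt t → Pt t → Pt t → ℕ
        collinear x y z = ∑[ c ∈ scalars ] 𝟙 (line x y c ≟ₚ z)

        -- The obstructions are added up, so that an average below 1 over all triples yields a
        -- triple with none.
        defects : Pt t → Pt t → Pt t → ℕ
        defects x y z = 𝟙 (sparse? x y) + (𝟙 (sparse? y z) + (𝟙 (sparse? x z) + (𝟙 (x ≟ₚ y) + collinear x y z)))

        -- Each sparsity condition leaves the third vertex free and costs `a * B`. The coincidence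
        -- `x = y` costs at most `a * a`, and the line through any two vertices has `q` parameters,
        -- each met by at most one `z`.
        ∑-defects : ∀ v → let a = length (A v) ; B = sparsePairs v in
          ∑[ x ∈ A v ] ∑[ y ∈ A v ] ∑[ z ∈ A v ] defects x y z ≤ a * B + (a * B + (a * B + (a * a + a * (a * q))))
        ∑-defects v = begin
          T defects                         ≡⟨ T-+ _ _ ⟩
          T s₁ + T _                        ≡⟨ cong (T s₁ +_) (T-+ _ _) ⟩
          T s₁ + (T s₂ + T _)               ≡⟨ cong (λ m → T s₁ + (T s₂ + m)) (T-+ _ _) ⟩
          T s₁ + (T s₂ + (T s₃ + T _))      ≡⟨ cong (λ m → T s₁ + (T s₂ + (T s₃ + m))) (T-+ _ _) ⟩
          T s₁ + (T s₂ + (T s₃ + (T s₄ + T collinear)))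
            ≤⟨ +-mono-≤ (≤-reflexive Ts₁) (+-mono-≤ (≤-reflexive Ts₂) (+-mono-≤ (≤-reflexive Ts₃) (+-mono-≤ Ts₄ Ts₅))) ⟩
          a * B + (a * B + (a * B + (a * a + a * (a * q)))) ∎
          where
          a = length (A v)
          B = sparsePairs v
          T : (Pt t → Pt t → Pt t → ℕ) → ℕ
          T h = ∑[ x ∈ A v ] ∑[ y ∈ A v ] ∑[ z ∈ A v ] h x y z
          T-+ : ∀ g h → T (λ x y z → g x y z + h x y z) ≡ T g + T h
          T-+ g h = trans (∑-cong (A v) (λ x → trans (∑-cong (A v) (λ y → ∑-+ (A v) (g x y) (h x y))) (∑-+ (A v) _ _))) (∑-+ (A v) _ _)
          s₁ s₂ s₃ s₄ : Pt t → Pt t → Pt t → ℕ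
          s₁ x y z = 𝟙 (sparse? x y)
          s₂ x y z = 𝟙 (sparse? y z)
          s₃ x y z = 𝟙 (sparse? x z)
          s₄ x y z = 𝟙 (x ≟ₚ y)
          Ts₁ : T s₁ ≡ a * B
          Ts₁ = trans (∑-cong (A v) (λ x → trans (∑-cong (A v) (λ y → ∑-const (A v) _)) (∑-*ˡ (A v) a _))) (∑-*ˡ (A v) a _)
          Ts₂ : T s₂ ≡ a * B
          Ts₂ = ∑-const (A v) B
          Ts₃ : T s₃ ≡ a * B
          Ts₃ = trans (∑-cong (A v) (λ x → ∑-const (A v) _)) (∑-*ˡ (A v) a _)
          Ts₄ : T s₄ ≤ a * a
          Ts₄ = begin
            T s₄                                              ≡⟨ ∑-cong (A v) (λ x → trans (∑-cong (A v) (λ y → ∑-const (A v) _)) (∑-*ˡ (A v) a _)) ⟩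
            ∑[ x ∈ A v ] a * (∑[ y ∈ A v ] 𝟙 (x ≟ₚ y))        ≤⟨ ∑-mono (A v) (λ x → *-monoʳ-≤ a (∑-unique-≤1 _≟ₚ_ (A! v) x)) ⟩
            ∑[ x ∈ A v ] a * 1                                ≡⟨ ∑-const (A v) (a * 1) ⟩
            a * (a * 1)                                       ≡⟨ cong (a *_) (*-identityʳ a) ⟩
            a * a                                             ∎
          Ts₅ : T collinear ≤ a * (a * q)
          Ts₅ = begin
            T collinear                        ≤⟨ ∑-mono (A v) (λ x → ∑-mono (A v) (λ y → on-line x y)) ⟩
            ∑[ x ∈ A v ] ∑[ y ∈ A v ] q        ≡⟨ ∑-cong (A v) (λ x → ∑-const (A v) q) ⟩
            ∑[ x ∈ A v ] a * q                 ≡⟨ ∑-const (A v) (a * q) ⟩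
            a * (a * q)                        ∎
            where
            on-line : ∀ x y → ∑ (A v) (collinear x y) ≤ q
            on-line x y = begin
              ∑ (A v) (collinear x y)                                ≡⟨ ∑-swap (A v) scalars _ ⟩
              ∑[ c ∈ scalars ] ∑[ z ∈ A v ] 𝟙 (line x y c ≟ₚ z)      ≤⟨ ∑-mono scalars (λ c → ∑-unique-≤1 _≟ₚ_ (A! v) (line x y c)) ⟩
              ∑[ c ∈ scalars ] 1                                     ≡⟨ ∑-const scalars 1 ⟩
              length scalars * 1                                     ≡⟨ *-identityʳ _ ⟩
              length scalars                                         ≡⟨ length-scalars ⟩
              q                                                      ∎

        defects-free-triple : ∀ v →
          640 * (q * (q * sparsePairs v)) + n * n < 4 * (4 * (q * length (A v)) * (4 * (q * length (A v)))) →
          ∃ λ x → x ∈ A v × ∃ λ y → y ∈ A v × ∃ λ z → z ∈ A v × defects x y z < 1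
        defects-free-triple v rich =
          let x , x∈ , lt₁ = ∑<∑⇒∃< (A v) (≤-<-trans (∑-defects v) (subst (total <_) (sym cube) total<a³))
              y , y∈ , lt₂ = ∑<∑⇒∃< (A v) lt₁
              z , z∈ , lt₃ = ∑<∑⇒∃< (A v) lt₂
          in x , x∈ , y , y∈ , z , z∈ , lt₃
          where
          a = length (A v)
          B = sparsePairs v
          total = a * B + (a * B + (a * B + (a * a + a * (a * q))))
          cube : ∑[ x ∈ A v ] ∑[ y ∈ A v ] ∑[ z ∈ A v ] 1 ≡ a * (a * (a * 1))
          cube = trans (∑-cong (A v) (λ x → trans (∑-cong (A v) (λ y → ∑-const (A v) 1)) (∑-const (A v) _))) (∑-const (A v) _)
          -- The constant 640 is 64 times 10, and 64 is the coefficient on the right of the rich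
          -- inequality.
          10B≤aa : 10 * B ≤ a * a
          10B≤aa = *-cancelˡ-≤ (64 * (q * q)) {{m*n≢0 64 (q * q) {{_}} {{m*n≢0 q q}}}} (begin
            64 * (q * q) * (10 * B)                  ≡⟨ lhs q B ⟩
            640 * (q * (q * B))                      ≤⟨ m≤m+n _ (n * n) ⟩
            640 * (q * (q * B)) + n * n              ≤⟨ <⇒≤ rich ⟩
            4 * (4 * (q * a) * (4 * (q * a)))        ≡⟨ rhs q a ⟩
            64 * (q * q) * (a * a)                   ∎)
            where
            lhs : ∀ q B → 64 * (q * q) * (10 * B) ≡ 640 * (q * (q * B))
            lhs = solve-∀
            rhs : ∀ q a → 4 * (4 * (q * a) * (4 * (q * a))) ≡ 64 * (q * q) * (a * a)
            rhs = solve-∀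
          n<8qa : n < 8 * (q * a)
          n<8qa = ≰⇒> λ 8qa≤n → <-irrefl refl (begin-strict
            n * n                                    ≤⟨ m≤n+m (n * n) _ ⟩
            640 * (q * (q * B)) + n * n              <⟨ rich ⟩
            4 * (4 * (q * a) * (4 * (q * a)))        ≡⟨ square (q * a) ⟩
            8 * (q * a) * (8 * (q * a))              ≤⟨ *-mono-≤ 8qa≤n 8qa≤n ⟩
            n * n                                    ∎)
            where
            square : ∀ m → 4 * (4 * m * (4 * m)) ≡ 8 * m * (8 * m)
            square = solve-∀
          4q<a : 4 * q < a
          4q<a = *-cancelˡ-< (8 * q) _ _ (begin-strict
            8 * q * (4 * q)        ≡⟨ lhs q ⟩
            32 * (q * q)           ≤⟨ 32qq≤n ⟩
            n                      <⟨ n<8qa ⟩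
            8 * (q * a)            ≡⟨ *-assoc 8 q a ⟨
            8 * q * a              ∎)
            where
            lhs : ∀ q → 8 * q * (4 * q) ≡ 32 * (q * q)
            lhs = solve-∀
          10+10q≤4a : 10 + 10 * q ≤ 4 * a
          10+10q≤4a = begin
            10 + 10 * q            ≤⟨ +-monoˡ-≤ (10 * q) (≤-trans (m≤m+n 10 14) (*-monoʳ-≤ 6 4≤q)) ⟩
            6 * q + 10 * q         ≡⟨ sixteen q ⟩
            4 * (4 * q)            ≤⟨ *-monoʳ-≤ 4 (<⇒≤ 4q<a) ⟩
            4 * a                  ∎
            where
            sixteen : ∀ q → 6 * q + 10 * q ≡ 4 * (4 * q)
            sixteen = solve-∀
          -- The sparse pairs use at most 3/10 of all triples, coincidences and collinear triples at
          -- most 4/10.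
          total<a³ : total < a * (a * (a * 1))
          total<a³ = *-cancelˡ-< 10 _ _ (begin-strict
            10 * total                                       ≡⟨ collect a B q ⟩
            3 * (a * (10 * B)) + a * a * (10 + 10 * q)       ≤⟨ +-mono-≤ (*-monoʳ-≤ 3 (*-monoʳ-≤ a 10B≤aa)) (*-monoʳ-≤ (a * a) 10+10q≤4a) ⟩
            3 * (a * (a * a)) + a * a * (4 * a)              ≡⟨ seven a ⟩
            7 * (a * (a * (a * 1)))                          <⟨ *-monoˡ-< (a * (a * (a * 1))) (m≤m+n 8 2) ⟩
            10 * (a * (a * (a * 1)))                         ∎)
            where
            instance
              a≢0 : NonZero a
              a≢0 = >-nonZero (≤-<-trans z≤n 4q<a)
              a1≢0 : NonZero (a * 1)
              a1≢0 = m*n≢0 a 1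
              aa1≢0 : NonZero (a * (a * 1))
              aa1≢0 = m*n≢0 a (a * 1)
              a³≢0 : NonZero (a * (a * (a * 1)))
              a³≢0 = m*n≢0 a (a * (a * 1))
            collect : ∀ a B q → 10 * (a * B + (a * B + (a * B + (a * a + a * (a * q))))) ≡ 3 * (a * (10 * B)) + a * a * (10 + 10 * q)
            collect = solve-∀
            seven : ∀ a → 3 * (a * (a * a)) + a * a * (4 * a) ≡ 7 * (a * (a * (a * 1)))
            seven = solve-∀

        -- The eight adjacency patterns.

        codeg₃ : Pt t → Pt t → Pt t → ℕ
        codeg₃ x y z = ∑[ w ∈ U ] E x w * E y w * E z w

        exactly-two : ∀ x y z → q * (q * (q * codeg₃ x y z)) ≤ Q → ¬ (q * (q * (q * codeg x y)) ≤ Q) →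
                      ∃ λ w → w ∈ U × x · w ≡ 1ᶠ × y · w ≡ 1ᶠ × ¬ (z · w ≡ 1ᶠ)
        exactly-two x y z c₃≤ c≰ =
          let w , w∈ , lt = ∑<∑⇒∃< U {λ w → E x w * E y w * E z w} {λ w → E x w * E y w}
                (*-cancelˡ-< q _ _ (*-cancelˡ-< q _ _ (*-cancelˡ-< q _ _ (≤-<-trans c₃≤ (≰⇒> c≰)))))
          in w , w∈ , decode (x · w ≟ᶠ 1ᶠ) (y · w ≟ᶠ 1ᶠ) (z · w ≟ᶠ 1ᶠ) lt
          where
          decode : ∀ {P R S : Set} (d : Dec P) (e : Dec R) (f : Dec S) →
                   𝟙 d * 𝟙 e * 𝟙 f < 𝟙 d * 𝟙 e → P × R × ¬ S
          decode (yes p) (yes r) (no ¬s) _ = p , r , ¬s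
          decode (yes _) (yes _) (yes _) (s≤s ())
          decode (yes _) (no _)  _       ()
          decode (no _)  _       _       ()

        -- At most `2Q/q²` neighbours of `x` are shared with `y` or `z`, while goodness and
        -- `640Q≤qn` give `x` at least `160Q/q²` of them.
        exactly-one : ∀ x y z → Good x → x ≢ y → x ≢ z →
                      ∃ λ w → w ∈ U × x · w ≡ 1ᶠ × ¬ (y · w ≡ 1ᶠ) × ¬ (z · w ≡ 1ᶠ)
        exactly-one x y z (n≤4qD , _) x≢y x≢z =
          let w , w∈ , lt = ∑<∑⇒∃< U {λ w → E x w * E y w + E x w * E z w} {E x} few
          in w , w∈ , decode (x · w ≟ᶠ 1ᶠ) (y · w ≟ᶠ 1ᶠ) (z · w ≟ᶠ 1ᶠ) lt
          where
          decode : ∀ {P R S : Set} (d : Dec P) (e : Dec R) (f : Dec S) →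
                   𝟙 d * 𝟙 e + 𝟙 d * 𝟙 f < 𝟙 d → P × ¬ R × ¬ S
          decode (yes p) (no ¬r) (no ¬s) _ = p , ¬r , ¬s
          decode (yes _) (yes _) _       (s≤s ())
          decode (yes _) (no _)  (yes _) (s≤s ())
          decode (no _)  _       _       ()
          codeg≤ : ∀ y → x ≢ y → q * (q * codeg x y) ≤ Q
          codeg≤ y x≢y = ≤-trans (*-monoʳ-≤ q (*-monoʳ-≤ q (∑U≤∑P _))) (solutions₂-≤ x≢y)
          instance
            Q≢0 : NonZero Q
            Q≢0 = m^n≢0 q t
          few : ∑[ w ∈ U ] E x w * E y w + E x w * E z w < D x
          few = *-cancelˡ-< q _ _ (*-cancelˡ-< q _ _ (*-cancelˡ-< 4 _ _ (begin-strict
            4 * (q * (q * (∑[ w ∈ U ] E x w * E y w + E x w * E z w)))   ≡⟨ cong (λ m → 4 * (q * (q * m))) (∑-+ U _ _) ⟩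
            4 * (q * (q * (codeg x y + codeg x z)))                      ≡⟨ cong (4 *_) (trans (cong (q *_) (*-distribˡ-+ q _ _)) (*-distribˡ-+ q _ _)) ⟩
            4 * (q * (q * codeg x y) + q * (q * codeg x z))              ≤⟨ *-monoʳ-≤ 4 (+-mono-≤ (codeg≤ y x≢y) (codeg≤ z x≢z)) ⟩
            4 * (Q + Q)                                                  ≡⟨ eight Q ⟩
            8 * Q                                                        <⟨ *-monoˡ-< Q (m≤m+n 9 631) ⟩
            640 * Q                                                      ≤⟨ 640Q≤qn ⟩
            q * n                                                        ≤⟨ *-monoʳ-≤ q n≤4qD ⟩
            q * (4 * (q * D x))                                          ≡⟨ swap q (q * D x) ⟩
            4 * (q * (q * D x))                                          ∎)))
            where
            eight : ∀ m → 4 * (m + m) ≡ 8 * m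
            eight = solve-∀
            swap : ∀ q m → q * (4 * m) ≡ 4 * (q * m)
            swap = solve-∀

        -- Each of the three degrees is at most `Q/q`, the size of a hyperplane, and `n` exceeds
        -- `3Q/q`.
        none : ∀ x y z v → x · v ≡ 1ᶠ → y · v ≡ 1ᶠ → z · v ≡ 1ᶠ →
               ∃ λ w → w ∈ U × ¬ (x · w ≡ 1ᶠ) × ¬ (y · w ≡ 1ᶠ) × ¬ (z · w ≡ 1ᶠ)
        none x y z v xv yv zv =
          let w , w∈ , lt = ∑<∑⇒∃< U {λ w → E x w + (E y w + E z w)} {λ _ → 1} few
          in w , w∈ , decode (x · w ≟ᶠ 1ᶠ) (y · w ≟ᶠ 1ᶠ) (z · w ≟ᶠ 1ᶠ) lt
          where
          decode : ∀ {P R S : Set} (d : Dec P) (e : Dec R) (f : Dec S) →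
                   𝟙 d + (𝟙 e + 𝟙 f) < 1 → ¬ P × ¬ R × ¬ S
          decode (no ¬p) (no ¬r) (no ¬s) _ = ¬p , ¬r , ¬s
          decode (no _)  (no _)  (yes _) (s≤s ())
          decode (no _)  (yes _) _       (s≤s ())
          decode (yes _) _       _       (s≤s ())
          D≤ : ∀ x → x · v ≡ 1ᶠ → q * D x ≤ Q
          D≤ x xv = ≤-trans (*-monoʳ-≤ q (∑U≤∑P _)) (≤-reflexive (solutions₁ x v xv))
          instance
            Q≢0 : NonZero Q
            Q≢0 = m^n≢0 q t
          few : ∑[ w ∈ U ] E x w + (E y w + E z w) < ∑[ w ∈ U ] 1
          few = *-cancelˡ-< q _ _ (begin-strict
            q * (∑[ w ∈ U ] E x w + (E y w + E z w))      ≡⟨ cong (q *_) (trans (∑-+ U _ _) (cong (D x +_) (∑-+ U _ _))) ⟩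
            q * (D x + (D y + D z))                       ≡⟨ trans (*-distribˡ-+ q _ _) (cong (q * D x +_) (*-distribˡ-+ q _ _)) ⟩
            q * D x + (q * D y + q * D z)                 ≤⟨ +-mono-≤ (D≤ x xv) (+-mono-≤ (D≤ y yv) (D≤ z zv)) ⟩
            Q + (Q + Q)                                   ≡⟨ three Q ⟩
            3 * Q                                         <⟨ *-monoˡ-< Q (m≤m+n 4 636) ⟩
            640 * Q                                       ≤⟨ 640Q≤qn ⟩
            q * n                                         ≡⟨ cong (q *_) (trans (∑-const U 1) (*-identityʳ n)) ⟨
            q * (∑[ w ∈ U ] 1)                            ∎)
            where
            three : ∀ m → m + (m + m) ≡ 3 * m
            three = solve-∀

        shatter-defect-free : ∀ x y z v → v ∈ U → x ∈ A v → y ∈ A v → z ∈ A v → defects x y z < 1 → VCdim≥ F U 3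
        shatter-defect-free x y z v v∈ x∈A y∈A z∈A free = go (∈A⁻ {v} x∈A) (∈A⁻ {v} y∈A) (∈A⁻ {v} z∈A)
          where
          s₁ = 𝟙 (sparse? x y)
          s₂ = 𝟙 (sparse? y z)
          s₃ = 𝟙 (sparse? x z)
          s₄ = 𝟙 (x ≟ₚ y)
          tail₁ : s₂ + (s₃ + (s₄ + collinear x y z)) < 1
          tail₁ = ≤-<-trans (m≤n+m _ s₁) free
          tail₂ : s₃ + (s₄ + collinear x y z) < 1
          tail₂ = ≤-<-trans (m≤n+m _ s₂) tail₁
          tail₃ : s₄ + collinear x y z < 1
          tail₃ = ≤-<-trans (m≤n+m _ s₃) tail₂
          dense-xy : ¬ (q * (q * (q * codeg x y)) ≤ Q)
          dense-xy = 𝟙<1⇒¬ (sparse? x y) (≤-<-trans (m≤m+n s₁ _) free)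
          dense-yz : ¬ (q * (q * (q * codeg y z)) ≤ Q)
          dense-yz = 𝟙<1⇒¬ (sparse? y z) (≤-<-trans (m≤m+n s₂ _) tail₁)
          dense-xz : ¬ (q * (q * (q * codeg x z)) ≤ Q)
          dense-xz = 𝟙<1⇒¬ (sparse? x z) (≤-<-trans (m≤m+n s₃ _) tail₂)
          x≢y : x ≢ y
          x≢y = 𝟙<1⇒¬ (x ≟ₚ y) (≤-<-trans (m≤m+n s₄ _) tail₃)
          off-line : ∀ c → z ≢ line x y c
          off-line c z≡ = 𝟙<1⇒¬ (line x y c ≟ₚ z) (≤-<-trans
            (≤-trans (∈⇒≤∑ (λ c → 𝟙 (line x y c ≟ₚ z)) (∈-scalars c)) (m≤n+m _ s₄)) tail₃) (sym z≡)

          go : x ∈ U × Good x × x · v ≡ 1ᶠ → y ∈ U × Good y × y · v ≡ 1ᶠ → z ∈ U × Good z × z · v ≡ 1ᶠ → VCdim≥ F U 3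
          go (x∈ , gx , xv) (y∈ , gy , yv) (z∈ , gz , zv) = shatter₃ x∈ y∈ z∈ λ where
              true  true  true  → v , v∈ , xv , yv , zv
              true  true  false → w-xy
              true  false true  → let w , w∈ , xw , zw , ¬yw = w-xz in w , w∈ , xw , ¬yw , zw
              false true  true  → let w , w∈ , yw , zw , ¬xw = w-yz in w , w∈ , ¬xw , yw , zw
              true  false false → exactly-one x y z gx x≢y x≢z
              false true  false → let w , w∈ , yw , ¬xw , ¬zw = exactly-one y x z gy (≢-sym x≢y) y≢z in w , w∈ , ¬xw , yw , ¬zw
              false false true  → let w , w∈ , zw , ¬xw , ¬yw = exactly-one z x y gz (≢-sym x≢z) (≢-sym y≢z) in w , w∈ , ¬xw , ¬yw , zw
              false false false → none x y z v xv yv zv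
            where
            xyz : q * (q * (q * codeg₃ x y z)) ≤ Q
            xyz = ≤-trans (*-monoʳ-≤ q (*-monoʳ-≤ q (*-monoʳ-≤ q (∑U≤∑P _))))
                          (≤-reflexive (solutions₃ x y z v xv yv zv x≢y off-line))
            permuted : ∀ {m} → codeg₃ x y z ≡ m → q * (q * (q * m)) ≤ Q
            permuted eq = subst (λ m → q * (q * (q * m)) ≤ Q) eq xyz
            rotate : ∀ a b c → a * b * c ≡ b * c * a
            rotate = solve-∀
            swap : ∀ a b c → a * b * c ≡ a * c * b
            swap = solve-∀
            w-xy = exactly-two x y z xyz dense-xy
            w-xz = exactly-two x z y (permuted (∑-cong U (λ w → swap (E x w) (E y w) (E z w)))) dense-xz
            w-yz = exactly-two y z x (permuted (∑-cong U (λ w → rotate (E x w) (E y w) (E z w)))) dense-yz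
            -- The vertex `w-xy` is adjacent to `x` and `y` but not to `z`, so `z` differs from
            -- both.
            x≢z : x ≢ z
            x≢z refl = let _ , _ , xw , _ , ¬xw = w-xy in ¬xw xw
            y≢z : y ≢ z
            y≢z refl = let _ , _ , _ , yw , ¬yw = w-xy in ¬yw yw

        vc≥3 : VCdim≥ F U 3
        vc≥3 =
          let v , v∈ , rich = rich-vertex
              x , x∈ , y , y∈ , z , z∈ , free = defects-free-triple v rich
          in shatter-defect-free x y z v v∈ x∈ y∈ z∈ free

-- From the size hypotheses to the constant.

module _ (F : FiniteField) {t : ℕ} {U : List (Point F t)} (vertices : IsVertexSet F U)
         (C : ℕ) (4^t<C : 4 ^ t < C) (640≤C : 640 ≤ C) where
  open FiniteField F using () renaming (order to q)
  open Graph F {t}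
  open Vertices U (proj₁ vertices) (proj₂ vertices)
  open ≤-Reasoning

  private instance
    C≢0 : NonZero C
    C≢0 = >-nonZero (≤-trans (s≤s z≤n) 640≤C)
    qQ≢0 : NonZero (q * Q)
    qQ≢0 = m*n≢0 q Q {{q≢0}} {{m^n≢0 q t}}

  -- Over a smaller field `n ≤ Q ≤ 4 ^ t < C`, which contradicts the hypothesis: small fields are
  -- excluded by the size of the constant.
  large-order : C * C * (q * Q) ≤ n * n → 4 ≤ q
  large-order big = ≮⇒≥ λ q<4 → <-irrefl refl (begin-strict
    n * n              ≤⟨ *-mono-≤ n≤Q n≤Q ⟩
    Q * Q              ≤⟨ *-mono-≤ (^-monoˡ-≤ t (<⇒≤ q<4)) (^-monoˡ-≤ t (<⇒≤ q<4)) ⟩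
    4 ^ t * 4 ^ t      <⟨ *-mono-< 4^t<C 4^t<C ⟩
    C * C              ≤⟨ m≤m*n (C * C) (q * Q) ⟩
    C * C * (q * Q)    ≤⟨ big ⟩
    n * n              ∎)

  edge-bound : C * C * (q * Q) ≤ n * n → 65 * (q * Q) ≤ n * n
  edge-bound = ≤-trans (*-monoˡ-≤ (q * Q) (≤-trans (m≤m+n 65 575) (≤-trans 640≤C (m≤m*n C C))))

  nonempty : C * C * (q * Q) ≤ n * n → 0 < n
  nonempty big with n
  ... | suc _ = z<s
  ... | zero  = contradiction (≤-trans (≤-trans (>-nonZero⁻¹ (C * C) {{m*n≢0 C C}}) (m≤m*n (C * C) (q * Q))) big) λ ()

  large⇒vc≥2 : C ^ 2 * q ^ (t + 1) ≤ n ^ 2 → VCdim≥ F U 2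
  large⇒vc≥2 hyp = vc≥2 (large-order big) (nonempty big) (edge-bound big)
    where
    big : C * C * (q * Q) ≤ n * n
    big = subst₂ _≤_ (cong₂ _*_ (square C) (cong (q ^_) (+-comm t 1))) (square n) hyp
      where
      square : ∀ m → m ^ 2 ≡ m * m
      square m = cong (m *_) (*-identityʳ m)

  -- Here the required size already exceeds the number `Q` of all points; the condition on `t`
  -- amounts to `t ≤ 2`.
  low-dimension-vacuous : t * 14 ≤ 7 * t + 19 → ¬ (C ^ 14 * q ^ (7 * t + 19) ≤ n ^ 14)
  low-dimension-vacuous le hyp = <-irrefl refl (begin-strict
    n ^ 14                          ≤⟨ ^-monoˡ-≤ 14 n≤Q ⟩
    Q ^ 14                          ≡⟨ ^-*-assoc q t 14 ⟩
    q ^ (t * 14)                    ≤⟨ ^-monoʳ-≤ q le ⟩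
    q ^ (7 * t + 19)                <⟨ m<m*n _ (C ^ 14) {{m^n≢0 q (7 * t + 19)}} (<-≤-trans (≤-trans (m≤m+n 2 638) 640≤C) (m≤m*n C (C ^ 13) {{m^n≢0 C 13}})) ⟩
    q ^ (7 * t + 19) * C ^ 14       ≡⟨ *-comm (q ^ (7 * t + 19)) (C ^ 14) ⟩
    C ^ 14 * q ^ (7 * t + 19)       ≤⟨ hyp ⟩
    n ^ 14                          ∎)

large⇒vc≥3 : ∀ (F : FiniteField) t {U : List (Point F t)} → IsVertexSet F U →
  ∀ C → 4 ^ t < C → 640 ≤ C → let q = FiniteField.order F ; n = length U in
  C ^ 14 * q ^ (7 * t + 19) ≤ n ^ 14 → C * q ^ (t ∸ 1) ≤ n → VCdim≥ F U 3
large⇒vc≥3 F 0 V C lt le hyp _ = contradiction hyp (low-dimension-vacuous F V C lt le z≤n)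
large⇒vc≥3 F 1 V C lt le hyp _ = contradiction hyp (low-dimension-vacuous F V C lt le (m≤m+n 14 12))
large⇒vc≥3 F 2 V C lt le hyp _ = contradiction hyp (low-dimension-vacuous F V C lt le (m≤m+n 28 5))
large⇒vc≥3 F t@(suc (suc (suc s))) {U} V C lt le _ CR≤n =
  vc≥3 (large-order F V C lt le big) (nonempty F V C lt le big)
    (≤-trans (*-monoˡ-≤ (q * Q) (m≤m+n 4 61)) (edge-bound F V C lt le big)) 640Q≤qn 32qq≤n
  where
  open FiniteField F using () renaming (order to q)
  open Graph F {t}
  open Vertices U (proj₁ V) (proj₂ V)
  open ≤-Reasoning
  R = q ^ suc (suc s)
  -- This is where `t ≥ 3` enters: `R = q ^ (t - 1)` is at least `q * q`, so `q * Q = q * q * R` is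
  -- at most `R * R`.
  qq≤R : q * q ≤ R
  qq≤R = *-monoʳ-≤ q (m≤m*n q (q ^ s) {{m^n≢0 q s}})
  left-comm : ∀ a b c → a * (b * c) ≡ b * (a * c)
  left-comm = solve-∀
  big : C * C * (q * Q) ≤ n * n
  big = begin
    C * C * (q * (q * R))     ≡⟨ cong (C * C *_) (*-assoc q q R) ⟨
    C * C * (q * q * R)       ≤⟨ *-monoʳ-≤ (C * C) (*-monoˡ-≤ R qq≤R) ⟩
    C * C * (R * R)           ≡⟨ regroup C R ⟩
    C * R * (C * R)           ≤⟨ *-mono-≤ CR≤n CR≤n ⟩
    n * n                     ∎
    where
    regroup : ∀ a b → a * a * (b * b) ≡ a * b * (a * b)
    regroup = solve-∀
  640Q≤qn : 640 * Q ≤ q * n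
  640Q≤qn = begin
    640 * (q * R)     ≤⟨ *-monoˡ-≤ (q * R) le ⟩
    C * (q * R)       ≡⟨ left-comm C q R ⟩
    q * (C * R)       ≤⟨ *-monoʳ-≤ q CR≤n ⟩
    q * n             ∎
  32qq≤n : 32 * (q * q) ≤ n
  32qq≤n = ≤-trans (*-mono-≤ (≤-trans (m≤m+n 32 608) le) qq≤R) CR≤n

theorem1p7 : (t : ℕ) → ∃ λ (C : ℕ) → (F : FiniteField) → (U : _) → IsVertexSet F {t} U →
    ((C ^ 2) * (FiniteField.order F ^ (t + 1)) ≤ length U ^ 2 → VCdim≥ F U 2) ×
    ((C ^ 14) * (FiniteField.order F ^ (7 * t + 19)) ≤ length U ^ 14 →
    C * FiniteField.order F ^ (t ∸ 1) ≤ length U → VCdim≥ F U 3)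
-- The factor `4 ^ t` forces `q` to be at least 4, and 640 is the constant of the counting argument;
-- the product depends on `t` only.
theorem1p7 t = 640 * 4 ^ t , λ F U V →
  large⇒vc≥2 F V (640 * 4 ^ t) bound₁ bound₂ , large⇒vc≥3 F t V (640 * 4 ^ t) bound₁ bound₂
  where
  instance
    4^t≢0 : NonZero (4 ^ t)
    4^t≢0 = m^n≢0 4 t
  bound₁ : 4 ^ t < 640 * 4 ^ t
  bound₁ = subst (4 ^ t <_) (*-comm (4 ^ t) 640) (m<m*n (4 ^ t) 640 (s≤s (s≤s z≤n)))
  bound₂ : 640 ≤ 640 * 4 ^ t
  bound₂ = m≤m*n 640 (4 ^ t)
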